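{- Let $\mathbb{F}_p$ be the field of prime order $p$ and $\overline{\mathbb{F}}_p$ its algebraic closure, and let $n\geq 3$. Then the geometry $\mathrm{Gr}_{1,n}(A_n(\overline{\mathbb{F}}_p))$ has infinite generating rank, while its embedding rank is equal to either $(n+1)^2-1$ or $(n+1)^2$.
   Context: $\mathrm{Gr}_{1,n}(A_n(\mathbb{K}))$: let $V$ be an $(n+1)$-dimensional vector space over $\mathbb{K}$. Points are the flags $(p,H)$ with $p$ a 1-dimensional subspace, $H$ an $n$-dimensional subspace, $p\subseteq H$. Lines are the sets $\{(p,X): X\supset S, \dim X=n\}$ for $p\subseteq S$, $\dim S=n-1$, and the sets $\{(x,H): \dim x=1, x\subseteq L\}$ for $L\subseteq H$, $\dim L=2$. A subspace of a point-line geometry is a set of points containing all points of every line meeting it in at least two points; the generating rank is the minimum cardinality of a set of points contained in no proper subspace. A (full) projective embedding of a point-line geometry $\Gamma$ is an injective map $e$ from the points of $\Gamma$ to the points of a projective space $\mathrm{PG}(W)$ ($W$ a vector space over some division ring) such that each line of $\Gamma$ is mapped onto a projective line of $\mathrm{PG}(W)$ and the image spans $\mathrm{PG}(W)$; its dimension is $\dim W$. The embedding rank of $\Gamma$ is the supremum of the dimensions of its projective embeddings. -}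

module Defs where

open import Level using (Level; _⊔_; Setω) renaming (suc to lsuc)
open import Algebra.Bundles using (Ring; CommutativeRing)
open import Algebra.Module.Bundles using (LeftModule)
open import Data.Nat using (ℕ; zero; suc; _≤_)
open import Data.Fin using (Fin)
import Data.Fin as F
open import Data.List using (List; []; _∷_; _++_; map)
open import Data.List.Relation.Unary.All using (All)
open import Data.Product using (Σ; ∃; _×_; _,_)
open import Relation.Nullary using (¬_)

record IsDivisionRing {r ℓ} (R : Ring r ℓ) : Set (r ⊔ ℓ) where
  open Ring R
  field
    nontrivial : ¬ (1# ≈ 0#)
    inverse    : ∀ x → ¬ (x ≈ 0#) → Σ Carrier λ y → (x * y ≈ 1#) × (y * x ≈ 1#)

IsField : ∀ {k ℓ} → CommutativeRing k ℓ → Set (k ⊔ ℓ)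
IsField K = IsDivisionRing (CommutativeRing.ring K)

module _ {k ℓ} (K : CommutativeRing k ℓ) where
  open CommutativeRing K

  natK : ℕ → Carrier
  natK zero    = 0#
  natK (suc n) = 1# + natK n

  evalPoly : List Carrier → Carrier → Carrier
  evalPoly []       x = 0#
  evalPoly (c ∷ cs) x = c + x * evalPoly cs x

  HasCharacteristic : ℕ → Set ℓ
  HasCharacteristic p = natK p ≈ 0#

  IsAlgebraicallyClosed : Set (k ⊔ ℓ)
  IsAlgebraicallyClosed =
    ∀ (c : Carrier) (cs : List Carrier) → ∃ λ x → evalPoly (c ∷ cs ++ 1# ∷ []) x ≈ 0#

  -- every element is a root of a monic polynomial with coefficients in the
  -- prime subfield (the image of ℕ in K)
  IsAlgebraicOverPrimeField : Set (k ⊔ ℓ)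
  IsAlgebraicOverPrimeField =
    ∀ (x : Carrier) → ∃ λ (ds : List ℕ) → evalPoly (map natK ds ++ 1# ∷ []) x ≈ 0#

  -- K is an algebraic closure of F_p  (p is assumed prime in the theorem)
  record IsAlgebraicClosureOfFp (p : ℕ) : Set (k ⊔ ℓ) where
    field
      isField        : IsField K
      characteristic : HasCharacteristic p
      algebraic      : IsAlgebraicOverPrimeField
      algClosed      : IsAlgebraicallyClosed

record Geometry a ℓ b c : Set (lsuc (a ⊔ ℓ ⊔ b ⊔ c)) where
  field
    Point : Set a
    _≃_   : Point → Point → Set ℓ
    Line  : Set b
    _∈L_  : Point → Line → Set c

module _ {a ℓ b c} (Γ : Geometry a ℓ b c) where
  open Geometry Γ

  record IsSubspace (S : Point → Set (a ⊔ ℓ)) : Set (a ⊔ ℓ ⊔ b ⊔ c) where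
    field
      resp   : ∀ {x y} → x ≃ y → S x → S y
      closed : ∀ (L : Line) (x y z : Point) → ¬ (x ≃ y) →
               x ∈L L → y ∈L L → S x → S y → z ∈L L → S z

  Generates : List Point → Set (lsuc (a ⊔ ℓ) ⊔ b ⊔ c)
  Generates xs = ∀ (S : Point → Set (a ⊔ ℓ)) → IsSubspace S → All S xs → ∀ x → S x

  HasInfiniteGeneratingRank : Set (lsuc (a ⊔ ℓ) ⊔ b ⊔ c)
  HasInfiniteGeneratingRank = ∀ (xs : List Point) → ¬ Generates xs

module _ {r ℓr m ℓm} {D : Ring r ℓr} (W : LeftModule D m ℓm) where
  open Ring D
  open LeftModule W

  sumᴹ : (k : ℕ) → (Fin k → Carrierᴹ) → Carrierᴹ
  sumᴹ zero    f = 0ᴹ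
  sumᴹ (suc k) f = f F.zero +ᴹ sumᴹ k (λ i → f (F.suc i))

  sumListᴹ : List Carrierᴹ → Carrierᴹ
  sumListᴹ []       = 0ᴹ
  sumListᴹ (v ∷ vs) = v +ᴹ sumListᴹ vs

  LinearlyIndependent : (k : ℕ) → (Fin k → Carrierᴹ) → Set (r ⊔ ℓr ⊔ ℓm)
  LinearlyIndependent k vs =
    ∀ (cs : Fin k → Carrier) → sumᴹ k (λ i → cs i *ₗ vs i) ≈ᴹ 0ᴹ → ∀ i → cs i ≈ 0#

  DimAtLeast : ℕ → Set (r ⊔ ℓr ⊔ m ⊔ ℓm)
  DimAtLeast N = Σ (Fin N → Carrierᴹ) λ vs → LinearlyIndependent N vs

  DimAtMost : ℕ → Set (r ⊔ ℓr ⊔ m ⊔ ℓm)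
  DimAtMost N = ∀ (k : ℕ) (vs : Fin k → Carrierᴹ) → LinearlyIndependent k vs → k ≤ N

  Proportionalᴹ : Carrierᴹ → Carrierᴹ → Set (r ⊔ ℓr ⊔ ℓm)
  Proportionalᴹ u v = ∃ λ (c : Carrier) → ¬ (c ≈ 0#) × (v ≈ᴹ c *ₗ u)

  Independent2 : Carrierᴹ → Carrierᴹ → Set (r ⊔ ℓr ⊔ ℓm)
  Independent2 u v = ∀ (s t : Carrier) → (s *ₗ u) +ᴹ (t *ₗ v) ≈ᴹ 0ᴹ → (s ≈ 0#) × (t ≈ 0#)

  InSpan2 : Carrierᴹ → Carrierᴹ → Carrierᴹ → Set (r ⊔ ℓm)
  InSpan2 u v w = ∃ λ (s : Carrier) → ∃ λ (t : Carrier) → w ≈ᴹ (s *ₗ u) +ᴹ (t *ₗ v)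

module _ {a ℓ b c} (Γ : Geometry a ℓ b c) where
  open Geometry Γ

  -- a projective embedding of Γ into PG(W), W a left vector space over the
  -- division ring D; a point of Γ is sent to (a representative vector of)
  -- a point of PG(W)
  record ProjectiveEmbedding {r ℓr m ℓm} (D : Ring r ℓr) (W : LeftModule D m ℓm)
         : Set (a ⊔ ℓ ⊔ b ⊔ c ⊔ r ⊔ ℓr ⊔ m ⊔ ℓm) where
    open Ring D
    open LeftModule W
    field
      isDivisionRing : IsDivisionRing D
      e              : Point → Carrierᴹ
      nonzero        : ∀ x → ¬ (e x ≈ᴹ 0ᴹ)
      well-defined   : ∀ x y → x ≃ y → Proportionalᴹ W (e x) (e y)
      injective      : ∀ x y → Proportionalᴹ W (e x) (e y) → x ≃ y
      onto-lines     : ∀ (L : Line) → Σ Carrierᴹ λ u → Σ Carrierᴹ λ v →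
                         Independent2 W u v ×
                         (∀ x → x ∈L L → InSpan2 W u v (e x)) ×
                         (∀ w → ¬ (w ≈ᴹ 0ᴹ) → InSpan2 W u v w →
                            ∃ λ x → x ∈L L × Proportionalᴹ W (e x) w)
      spanning       : ∀ (w : Carrierᴹ) → ∃ λ (cs : List (Carrier × Point)) →
                         w ≈ᴹ sumListᴹ W (map (λ { (s , x) → s *ₗ e x }) cs)

  record EmbeddingOfDimAtLeast (N : ℕ) : Setω where
    field
      r ℓr m ℓm  : Level
      D          : Ring r ℓr
      W          : LeftModule D m ℓm
      embedding  : ProjectiveEmbedding D W
      dimension  : DimAtLeast W N

  -- the embedding rank (supremum of dimensions of projective embeddings)
  -- lies in the interval [lo , hi]
  record EmbeddingRankBetween (lo hi : ℕ) : Setω where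
    field
      upper : ∀ {r ℓr m ℓm} (D : Ring r ℓr) (W : LeftModule D m ℓm) →
              ProjectiveEmbedding D W → DimAtMost W hi
      lower : EmbeddingOfDimAtLeast lo

module _ {k ℓk} (K : CommutativeRing k ℓk) (n : ℕ) where
  open CommutativeRing K

  Vect : Set k
  Vect = Fin (suc n) → Carrier

  sumK : (j : ℕ) → (Fin j → Carrier) → Carrier
  sumK zero    f = 0#
  sumK (suc j) f = f F.zero + sumK j (λ i → f (F.suc i))

  ⟪_,_⟫ : Vect → Vect → Carrier
  ⟪ f , v ⟫ = sumK (suc n) (λ i → f i * v i)

  NonZeroV : Vect → Set ℓk
  NonZeroV v = ¬ (∀ i → v i ≈ 0#)

  ProportionalV : Vect → Vect → Set (k ⊔ ℓk)
  ProportionalV u v = ∃ λ (c : Carrier) → ¬ (c ≈ 0#) × (∀ i → v i ≈ c * u i)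

  IndependentV : Vect → Vect → Set (k ⊔ ℓk)
  IndependentV u v = ∀ (s t : Carrier) → (∀ i → s * u i + t * v i ≈ 0#) → (s ≈ 0#) × (t ≈ 0#)

  combV : Carrier → Vect → Carrier → Vect → Vect
  combV s u t v i = s * u i + t * v i

  -- a flag (p , H): p = ⟨vec⟩ a 1-space, H = ker fun a hyperplane, p ⊆ H
  record GrPoint : Set (k ⊔ ℓk) where
    constructor flag
    field
      vec     : Vect
      fun     : Vect
      vec≢0   : NonZeroV vec
      fun≢0   : NonZeroV fun
      incident : ⟪ fun , vec ⟫ ≈ 0#

  open GrPoint

  _≃G_ : GrPoint → GrPoint → Set (k ⊔ ℓk)
  x ≃G y = ProportionalV (vec x) (vec y) × ProportionalV (fun x) (fun y)

  data GrLine : Set (k ⊔ ℓk) where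
    -- { (p , X) : X ⊇ S, dim X = n },  p = ⟨v⟩ ⊆ S = ker g ∩ ker h (dim S = n-1)
    pencil : (v g h : Vect) → NonZeroV v → IndependentV g h →
             ⟪ g , v ⟫ ≈ 0# → ⟪ h , v ⟫ ≈ 0# → GrLine
    -- { (x , H) : dim x = 1, x ⊆ L },  L = ⟨u , w⟩ ⊆ H = ker f (dim L = 2)
    flat   : (f u w : Vect) → NonZeroV f → IndependentV u w →
             ⟪ f , u ⟫ ≈ 0# → ⟪ f , w ⟫ ≈ 0# → GrLine

  _∈G_ : GrPoint → GrLine → Set (k ⊔ ℓk)
  x ∈G pencil v g h _ _ _ _ =
    ProportionalV v (vec x) × ∃ λ s → ∃ λ t → ProportionalV (combV s g t h) (fun x)
  x ∈G flat f u w _ _ _ _ =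
    ProportionalV f (fun x) × ∃ λ s → ∃ λ t → ProportionalV (combV s u t w) (vec x)

  Gr1n : Geometry (k ⊔ ℓk) (k ⊔ ℓk) (k ⊔ ℓk) (k ⊔ ℓk)
  Gr1n = record { Point = GrPoint ; _≃_ = _≃G_ ; Line = GrLine ; _∈L_ = _∈G_ }

record _×ω_ {a} (A : Set a) (B : Setω) : Setω where
  constructor _,ω_
  field
    fstω : A
    sndω : B

{-# OPTIONS --safe #-}
-- Generating rank. Finitely many flags have coordinates in a finite field F_q. The flags (v , f) such
-- that f vanishes on all vectors v^(q^j) form a subspace containing all F_q-rational flags. If
-- a^q = a + 1, it does not contain the flag of v = (1,a,0,…) and f = (-a,1,0,…).
--
-- Lower bound for the embedding rank. (v , f) ↦ v ⊗ f embeds the geometry in the matrices of trace 0.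
--
-- Upper bound. For a subspace S of the geometry, the relation "⟨ f , v ⟩ = 0 and the flag (v , f),
-- if v and f are nonzero, is in S" is linear in v and in f. Suppose that S contains the (n+1)² flags
-- (δᵢ , δⱼ) for i ≠ j, (δ₀ + δᵢ , δ₀ - δᵢ) for i ≠ 0, and (δ₀ + cδ₁ , cδ₀ - δ₁). Then the scalars a
-- such that S contains (δᵢ + aδⱼ , aδᵢ - δⱼ) for all i ≠ j form a field, by computations with a third
-- index k, and c is one of them; hence S contains all F_p(c)-rational flags. Given more than (n+1)²
-- independent vectors in an embedding, each a combination of images of flags, the flags involved are
-- rational over one field F_p(c). So the vectors are in the span of the images of (n+1)² flags, which
-- is absurd. Equality in K and in the division ring is not assumed decidable: these arguments are made
-- under a double negation, which is harmless as the conclusions are negative or inequalities in ℕ.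
module Submission where

open import Defs
open import Level using (_⊔_; Lift; lift; lower)
open import Algebra.Bundles using (Ring; CommutativeRing; RawRing)
open import Algebra.Module.Bundles using (LeftModule)
open import Algebra.Solver.Ring.AlmostCommutativeRing using (fromCommutativeRing; _-Raw-AlmostCommutative⟶_)
open import Data.Empty using (⊥-elim)
open import Data.Nat as ℕ using (_!; ℕ; zero; suc; _≤_; _<_; _^_; _∸_; z≤n; s≤s; NonZero)
import Data.Nat.Properties as ℕ
open import Data.Nat.Combinatorics using (_C_; nCk≡n!/k![n-k]!; k![n∸k]!∣n!; nCn≡1)
open import Data.Nat.Properties using (_!≢0; _!*_!≢0)
open import Data.Nat.Divisibility using (_∣_; divides; m∣m*n; ∣⇒≤)
open import Data.Nat.DivMod using (_/_; _%_; m≡m%n+[m/n]*n; m%n<n; m/n*n≡m)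
open import Data.Nat.Primality using (Prime; euclidsLemma; prime⇒nonZero; prime⇒nonTrivial)
open import Data.Fin as F using (Fin; zero; suc; toℕ; fromℕ; fromℕ<; inject₁; remQuot; combine; punchIn; funToFin; finToFun)
import Data.Fin.Properties as F
open import Data.List as List using (List; []; _∷_; _++_)
import Data.List.Properties as List
open import Data.List.Relation.Unary.All as All using (All; []; _∷_)
import Data.List.Relation.Unary.All.Properties as All
open import Data.Maybe using (Maybe; just; nothing)
open import Data.Product using (Σ; ∃; ∃-syntax; ∃₂; _×_; _,_; proj₁; proj₂; map₂)
open import Data.Product.Properties using (≡-dec)
open import Data.Sum using (inj₁; inj₂; [_,_]′)
open import Data.Unit using (⊤; tt)
open import Function using (_∘_; id)
open import Relation.Nullary using (¬_; Dec; yes; no)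
open import Relation.Nullary.Decidable using (¬¬-excluded-middle; decidable-stable)
open import Relation.Binary.PropositionalEquality as ≡ using (_≡_; _≢_)
import Algebra.Solver.Ring
import Algebra.Properties.Ring
import Algebra.Properties.Semiring.Mult
import Algebra.Properties.Semiring.Mult.TCOptimised
import Algebra.Properties.Semiring.Exp
import Algebra.Properties.Semiring.Sum
import Algebra.Properties.CommutativeMonoid.Sum
import Algebra.Properties.CommutativeSemiring.Exp
import Algebra.Properties.CommutativeSemiring.Binomial
import Algebra.Properties.CommutativeSemigroup
import Relation.Binary.Reasoning.Setoid
import Data.Vec.Functional as Vec
import Data.Vec.Functional.Properties as Vec

-- The two ranks diverge because K is a directed union of finite fields. Finitely many flags never
-- leave one F_q-bounded subspace, whereas each F_p(c), however large, is reached from the same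
-- number of flags. The (n+1)² - 1 flags without parameter account for the prime field, and the
-- single flag carrying `c` accounts for the gap between the two bounds. The condition on conjugates
-- survives along lines because v ↦ v^(q^j) is semilinear: it is additive and replaces a scalar by
-- its own conjugate. On the excluded flag, f takes the value a^q - a = 1 at v^q. A double negation
-- does not help where an embedding asks for positive data, such as a factor of proportionality or
-- the vanishing of a coefficient. There each nonzero vector needs a linear form with value 1 on it.
-- Such forms come from idempotents: the powers of an algebraic element repeat, so a positive power
-- is idempotent, and this is known without deciding whether the element is zero.

-- Ring solver with integer coefficients.

module IntegerCoefficientSolver {k ℓ} (K : CommutativeRing k ℓ) where
  open CommutativeRing K
  open import Algebra.Properties.Ring ring
  open import Algebra.Properties.Semiring.Mult semiring using (×-homo-+; ×1-homo-*) renaming (_×_ to _·_)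
  open Algebra.Properties.Semiring.Mult.TCOptimised semiring using (×ᵤ≈×) renaming (_×_ to _·′_)
  open Algebra.Properties.CommutativeSemigroup +-commutativeSemigroup using (interchange)
  open Relation.Binary.Reasoning.Setoid setoid

  normalise : ℕ × ℕ → ℕ × ℕ
  normalise (suc a , suc b) = normalise (a , b)
  normalise ab              = ab

  -- The integers as differences of naturals one of which is 0, so that equal coefficients are identical.
  differences : RawRing _ _
  differences = record
    { Carrier = ℕ × ℕ
    ; _≈_ = _≡_
    ; _+_ = λ { (a , b) (c , d) → normalise (a ℕ.+ c , b ℕ.+ d) }
    ; _*_ = λ { (a , b) (c , d) → normalise (a ℕ.* c ℕ.+ b ℕ.* d , a ℕ.* d ℕ.+ b ℕ.* c) }
    ; -_ = λ { (a , b) → b , a }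
    ; 0# = 0 , 0
    ; 1# = 1 , 0
    }

  -- The clauses make ⟦ 0 , 0 ⟧ and ⟦ 1 , 0 ⟧ reduce to 0# and 1#.
  ⟦_⟧ : ℕ × ℕ → Carrier
  ⟦ a , zero ⟧      = a ·′ 1#
  ⟦ a , b@(suc _) ⟧ = a · 1# - b · 1#

  ⟦⟧-difference : ∀ a b → ⟦ a , b ⟧ ≈ a · 1# - b · 1#
  ⟦⟧-difference a zero    = begin
    a ·′ 1#         ≈⟨ sym (×ᵤ≈× a 1#) ⟩
    a · 1#          ≈⟨ sym (+-identityʳ _) ⟩
    a · 1# + 0#     ≈⟨ +-congˡ (sym -0#≈0#) ⟩
    a · 1# - 0#     ∎
  ⟦⟧-difference a (suc b) = refl

  -‿medial : ∀ w x y z → (w + x) - (y + z) ≈ (w - y) + (x - z)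
  -‿medial w x y z = begin
    (w + x) - (y + z)       ≈⟨ +-congˡ (sym (-‿+-comm y z)) ⟩
    (w + x) + (- y + - z)   ≈⟨ interchange w x (- y) (- z) ⟩
    (w - y) + (x - z)       ∎

  -‿swap : ∀ x y → x - y ≈ - (y - x)
  -‿swap x y = begin
    x - y             ≈⟨ +-comm _ _ ⟩
    - y + x           ≈⟨ +-congˡ (sym (-‿involutive x)) ⟩
    - y + - - x       ≈⟨ -‿+-comm y (- x) ⟩
    - (y - x)         ∎

  difference-* : ∀ a b c d → (a * c + b * d) - (a * d + b * c) ≈ (a - b) * (c - d)
  difference-* a b c d = begin
    (a * c + b * d) - (a * d + b * c)     ≈⟨ -‿medial _ _ _ _ ⟩
    (a * c - a * d) + (b * d - b * c)     ≈⟨ +-cong (sym (x[y-z]≈xy-xz a c d)) (sym (x[y-z]≈xy-xz b d c)) ⟩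
    a * (c - d) + b * (d - c)             ≈⟨ +-congˡ (*-congˡ (-‿swap d c)) ⟩
    a * (c - d) + b * - (c - d)           ≈⟨ +-congˡ (sym (-‿distribʳ-* b _)) ⟩
    a * (c - d) + - (b * (c - d))         ≈⟨ +-congˡ (-‿distribˡ-* b _) ⟩
    a * (c - d) + - b * (c - d)           ≈⟨ sym (distribʳ _ _ _) ⟩
    (a - b) * (c - d)                     ∎

  ⟦normalise⟧ : ∀ a b → ⟦ normalise (a , b) ⟧ ≈ a · 1# - b · 1#
  ⟦normalise⟧ zero    zero    = ⟦⟧-difference 0 0
  ⟦normalise⟧ zero    (suc b) = refl
  ⟦normalise⟧ (suc a) zero    = ⟦⟧-difference (suc a) 0
  ⟦normalise⟧ (suc a) (suc b) = begin
    ⟦ normalise (a , b) ⟧                   ≈⟨ ⟦normalise⟧ a b ⟩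
    a · 1# - b · 1#                         ≈⟨ +-identityˡ _ ⟨
    0# + (a · 1# - b · 1#)                  ≈⟨ +-congʳ (-‿inverseʳ 1#) ⟨
    (1# - 1#) + (a · 1# - b · 1#)           ≈⟨ -‿medial _ _ _ _ ⟨
    (1# + a · 1#) - (1# + b · 1#)           ∎

  ·-bilinear : ∀ a b c d → (a ℕ.* c ℕ.+ b ℕ.* d) · 1# ≈ (a · 1#) * (c · 1#) + (b · 1#) * (d · 1#)
  ·-bilinear a b c d = trans (×-homo-+ 1# (a ℕ.* c) (b ℕ.* d)) (+-cong (×1-homo-* a c) (×1-homo-* b d))

  morphism : differences -Raw-AlmostCommutative⟶ fromCommutativeRing K
  morphism = record
    { ⟦_⟧ = ⟦_⟧
    ; +-homo = λ { (a , b) (c , d) → begin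
        ⟦ normalise (a ℕ.+ c , b ℕ.+ d) ⟧         ≈⟨ ⟦normalise⟧ (a ℕ.+ c) (b ℕ.+ d) ⟩
        (a ℕ.+ c) · 1# - (b ℕ.+ d) · 1#           ≈⟨ +-cong (×-homo-+ 1# a c) (-‿cong (×-homo-+ 1# b d)) ⟩
        (a · 1# + c · 1#) - (b · 1# + d · 1#)     ≈⟨ -‿medial _ _ _ _ ⟩
        (a · 1# - b · 1#) + (c · 1# - d · 1#)     ≈⟨ +-cong (⟦⟧-difference a b) (⟦⟧-difference c d) ⟨
        ⟦ a , b ⟧ + ⟦ c , d ⟧                     ∎ }
    ; *-homo = λ { (a , b) (c , d) → begin
        ⟦ normalise (a ℕ.* c ℕ.+ b ℕ.* d , a ℕ.* d ℕ.+ b ℕ.* c) ⟧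
          ≈⟨ ⟦normalise⟧ (a ℕ.* c ℕ.+ b ℕ.* d) (a ℕ.* d ℕ.+ b ℕ.* c) ⟩
        (a ℕ.* c ℕ.+ b ℕ.* d) · 1# - (a ℕ.* d ℕ.+ b ℕ.* c) · 1#
          ≈⟨ +-cong (·-bilinear a b c d) (-‿cong (·-bilinear a b d c)) ⟩
        (a · 1# * c · 1# + b · 1# * d · 1#) - (a · 1# * d · 1# + b · 1# * c · 1#)
          ≈⟨ difference-* _ _ _ _ ⟩
        (a · 1# - b · 1#) * (c · 1# - d · 1#)
          ≈⟨ *-cong (⟦⟧-difference a b) (⟦⟧-difference c d) ⟨
        ⟦ a , b ⟧ * ⟦ c , d ⟧                     ∎ }
    ; -‿homo = λ { (a , b) → begin
        ⟦ b , a ⟧               ≈⟨ ⟦⟧-difference b a ⟩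
        b · 1# - a · 1#         ≈⟨ -‿swap _ _ ⟩
        - (a · 1# - b · 1#)     ≈⟨ -‿cong (⟦⟧-difference a b) ⟨
        - ⟦ a , b ⟧             ∎ }
    ; 0-homo = refl
    ; 1-homo = refl
    }

  ⟦⟧-cong? : ∀ x y → Maybe (⟦ x ⟧ ≈ ⟦ y ⟧)
  ⟦⟧-cong? x y with ≡-dec ℕ._≟_ ℕ._≟_ x y
  ... | yes ≡.refl = just refl
  ... | no _       = nothing

  open Algebra.Solver.Ring differences (fromCommutativeRing K) morphism ⟦⟧-cong? public
    using (solve; _:=_; _:+_; _:*_; _:-_; :-_; con; Polynomial)

  :1 : ∀ {n} → Polynomial n
  :1 = con (1 , 0)

  :0 : ∀ {n} → Polynomial n
  :0 = con (0 , 0)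

-- Classical reasoning under a double negation.

infixl 1 _>>=_
_>>=_ : ∀ {a b} {A : Set a} {B : Set b} → ¬ ¬ A → (A → ¬ ¬ B) → ¬ ¬ B
(¬¬a >>= f) ¬b = ¬¬a λ a → f a ¬b

return : ∀ {a} {A : Set a} → A → ¬ ¬ A
return a ¬a = ¬a a

-- Deciding one index after another finds the counterexample. This is how a nonzero coordinate or a
-- pivot is picked below.
¬∀⇒¬¬∃¬ : ∀ {a n} {P : Fin n → Set a} → ¬ (∀ i → P i) → ¬ ¬ (∃[ i ] ¬ P i)
¬∀⇒¬¬∃¬ {n = zero}  ¬∀ _ = ¬∀ λ ()
¬∀⇒¬¬∃¬ {n = suc n} ¬∀ = ¬¬-excluded-middle >>= λ where
  (no ¬p) → return (zero , ¬p)
  (yes p) → ¬∀⇒¬¬∃¬ (λ ∀p → ¬∀ λ { zero → p ; (suc i) → ∀p i }) >>= λ (i , ¬pᵢ) → return (suc i , ¬pᵢ)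

¬¬-pull-Fin : ∀ {a n} {P : Fin n → Set a} → (∀ i → ¬ ¬ P i) → ¬ ¬ (∀ i → P i)
¬¬-pull-Fin ∀¬¬p ¬∀p = ¬∀⇒¬¬∃¬ ¬∀p λ (i , ¬pᵢ) → ∀¬¬p i ¬pᵢ

-- Binomial coefficients modulo a prime.

prime∤! : ∀ {p} → Prime p → ∀ k → k < p → ¬ (p ∣ k !)
prime∤! {p} pr zero    _     p∣1  = ℕ.<⇒≱ (ℕ.nonTrivial⇒n>1 p {{prime⇒nonTrivial pr}}) (∣⇒≤ p∣1)
prime∤! {p} pr (suc k) 1+k<p p∣! with euclidsLemma (suc k) (k !) pr p∣!
... | inj₁ p∣1+k = ℕ.<⇒≱ 1+k<p (∣⇒≤ p∣1+k)
... | inj₂ p∣k!  = prime∤! pr k (ℕ.<-trans (ℕ.n<1+n k) 1+k<p) p∣k!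

n∣n! : ∀ n .{{_ : NonZero n}} → n ∣ n !
n∣n! (suc n) = m∣m*n (n !)

-- In `p ! ≡ (p C k) * (k ! * (p ∸ k) !)` the prime divides the left side but neither factorial on
-- the right, whose factors are all smaller than `p`.
prime∣C : ∀ {p} → Prime p → ∀ k → 0 < k → k < p → p ∣ p C k
prime∣C {p} pr k 0<k k<p = [ id , (λ p∣ → ⊥-elim ([ prime∤! pr k k<p , prime∤! pr (p ∸ k) p∸k<p ]′
                                               (euclidsLemma (k !) ((p ∸ k) !) pr p∣))) ]′
  (euclidsLemma (p C k) (k ! ℕ.* (p ∸ k) !) pr
    (≡.subst (p ∣_) (≡.sym C*≡!) (n∣n! p)))
  where
  instance
    _ = prime⇒nonZero pr
    _ = k !* (p ∸ k) !≢0
  p∸k<p : p ∸ k < p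
  p∸k<p = ℕ.∸-monoʳ-< 0<k (ℕ.<⇒≤ k<p)
  C*≡! : (p C k) ℕ.* (k ! ℕ.* (p ∸ k) !) ≡ p !
  C*≡! = ≡.trans (≡.cong (ℕ._* (k ! ℕ.* (p ∸ k) !)) (nCk≡n!/k![n-k]! (ℕ.<⇒≤ k<p)))
                 (m/n*n≡m (k![n∸k]!∣n! (ℕ.<⇒≤ k<p)))

-- Sums, multiples and polynomial values in a commutative ring.

module CommutativeRingExtras {k ℓ} (K : CommutativeRing k ℓ) where
  open CommutativeRing K public renaming (zero to *-zero)
  open import Algebra.Properties.Ring ring public
  open Algebra.Properties.Semiring.Mult semiring public using (×-homo-+; ×1-homo-*; ×-assoc-*; ×-congʳ) renaming (_×_ to _·_)
  open Algebra.Properties.Semiring.Exp semiring public using (^-homo-*; ^-assocʳ; ^-congˡ; ^-congʳ) renaming (_^_ to _^ᴷ_)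
  open Algebra.Properties.CommutativeSemiring.Exp commutativeSemiring public using (^-distrib-*)
  open Algebra.Properties.Semiring.Sum semiring public
    using (sum; sum-cong-≋; sum-init-last; sum-replicate-zero; *-distribˡ-sum; *-distribʳ-sum; ∑-distrib-+)
  open IntegerCoefficientSolver K public using (solve; _:=_; _:+_; _:*_; _:-_; :-_; :1; :0)
  module ≈-R = Relation.Binary.Reasoning.Setoid setoid

  x-y≈0⇒x≈y : ∀ {x y} → x - y ≈ 0# → x ≈ y
  x-y≈0⇒x≈y {x} {y} = x∙y⁻¹≈ε⇒x≈y x y

  x≈y⇒x-y≈0 : ∀ {x y} → x ≈ y → x - y ≈ 0#
  x≈y⇒x-y≈0 = x≈y⇒x∙y⁻¹≈ε

  sum-zero : ∀ {n} {f : Fin n → Carrier} → (∀ i → f i ≈ 0#) → sum f ≈ 0#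
  sum-zero {n} f≈0 = trans (sum-cong-≋ f≈0) (sum-replicate-zero n)

  natK≡· : ∀ n → natK K n ≡ n · 1#
  natK≡· zero    = ≡.refl
  natK≡· (suc n) = ≡.cong (1# +_) (natK≡· n)

  natK-+ : ∀ m n → natK K (m ℕ.+ n) ≈ natK K m + natK K n
  natK-+ m n rewrite natK≡· (m ℕ.+ n) | natK≡· m | natK≡· n = ×-homo-+ 1# m n

  natK-* : ∀ m n → natK K (m ℕ.* n) ≈ natK K m * natK K n
  natK-* m n rewrite natK≡· (m ℕ.* n) | natK≡· m | natK≡· n = ×1-homo-* m n

  ·≈natK* : ∀ n x → n · x ≈ natK K n * x
  ·≈natK* n x rewrite natK≡· n = trans (×-congʳ n (sym (*-identityˡ x))) (sym (×-assoc-* n 1# x))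

  1^n≈1 : ∀ n → 1# ^ᴷ n ≈ 1#
  1^n≈1 zero    = refl
  1^n≈1 (suc n) = trans (*-identityˡ _) (1^n≈1 n)

  -- Splits off the leading term, since monic polynomials are given as `cs ++ 1# ∷ []`.
  evalPoly-snoc : ∀ cs c x → evalPoly K (cs ++ c ∷ []) x ≈ evalPoly K cs x + c * x ^ᴷ List.length cs
  evalPoly-snoc []       c x = solve 2 (λ c x → c :+ x :* :0 := :0 :+ c :* :1) refl c x
  evalPoly-snoc (d ∷ cs) c x = trans (+-congˡ (*-congˡ (evalPoly-snoc cs c x)))
    (solve 5 (λ d x e c t → d :+ x :* (e :+ c :* t) := (d :+ x :* e) :+ c :* (x :* t)) refl _ _ _ _ _)

-- The Frobenius map in characteristic p.

module CharacteristicP {k ℓ} (K : CommutativeRing k ℓ) {p : ℕ} (pr : Prime p) (char : HasCharacteristic K p) where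
  open CommutativeRingExtras K
  open ≈-R

  private instance
    p≢0 : NonZero p
    p≢0 = prime⇒nonZero pr

  natK-multiple : ∀ {n} → p ∣ n → natK K n ≈ 0#
  natK-multiple (divides q ≡.refl) = trans (natK-* q p) (trans (*-congˡ char) (zeroʳ _))

  natK-% : ∀ n → natK K (n % p) ≈ natK K n
  natK-% n = begin
    natK K (n % p)                                  ≈⟨ sym (+-identityʳ _) ⟩
    natK K (n % p) + 0#                             ≈⟨ +-congˡ (sym (natK-multiple (divides (n / p) ≡.refl))) ⟩
    natK K (n % p) + natK K (n / p ℕ.* p)           ≈⟨ sym (natK-+ (n % p) (n / p ℕ.* p)) ⟩
    natK K (n % p ℕ.+ n / p ℕ.* p)                  ≡⟨ ≡.cong (natK K) (≡.sym (m≡m%n+[m/n]*n n p)) ⟩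
    natK K n                                        ∎

  -- By `prime∣C` only the two outer terms of the binomial expansion survive.
  freshman : ∀ x y → (x + y) ^ᴷ p ≈ x ^ᴷ p + y ^ᴷ p
  freshman x y = go p ≡.refl
    where
    open Algebra.Properties.CommutativeSemiring.Binomial commutativeSemiring using (theorem; binomialTerm)
    term-zero : ∀ n k → p ≡ n → 0 < toℕ k → toℕ k < n → binomialTerm x y n k ≈ 0#
    term-zero n k ≡.refl 0<k k<n =
      trans (·≈natK* (n C toℕ k) _) (trans (*-congʳ (natK-multiple (prime∣C pr (toℕ k) 0<k k<n))) (zeroˡ _))
    -- `p` is a module parameter and cannot be matched on; through the equation it becomes `suc m`,
    -- for which the binomial sum unfolds into its first, middle and last terms.
    go : ∀ n → p ≡ n → (x + y) ^ᴷ n ≈ x ^ᴷ n + y ^ᴷ n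
    go zero    eq = ⊥-elim (ℕ.≢-nonZero⁻¹ p eq)
    go (suc m) eq = begin
      (x + y) ^ᴷ suc m                          ≈⟨ theorem (suc m) x y ⟩
      t zero + sum (λ k → t (suc k))            ≈⟨ +-congˡ (sum-init-last (λ k → t (suc k))) ⟩
      t zero + (sum (λ k → t (suc (inject₁ k))) + t (fromℕ (suc m)))
        ≈⟨ +-congˡ (+-congʳ (sum-zero λ k → term-zero (suc m) (suc (inject₁ k)) eq (s≤s z≤n)
             (s≤s (≡.subst (_< m) (≡.sym (F.toℕ-inject₁ k)) (F.toℕ<n k))))) ⟩
      t zero + (0# + t (fromℕ (suc m)))         ≈⟨ +-cong t-first (+-congˡ t-last) ⟩
      y ^ᴷ suc m + (0# + x ^ᴷ suc m)            ≈⟨ solve 2 (λ a b → a :+ (:0 :+ b) := b :+ a) refl _ _ ⟩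
      x ^ᴷ suc m + y ^ᴷ suc m                   ∎
      where
      t = binomialTerm x y (suc m)
      t-first : t zero ≈ y ^ᴷ suc m
      t-first = trans (+-identityʳ _) (*-identityˡ _)
      t-last : t (fromℕ (suc m)) ≈ x ^ᴷ suc m
      t-last rewrite F.toℕ-fromℕ m | nCn≡1 (suc m) | ℕ.n∸n≡0 m = trans (+-identityʳ _) (*-identityʳ _)

  frob : ℕ → Carrier → Carrier
  frob i x = x ^ᴷ (p ^ i)

  frob-cong : ∀ i {x y} → x ≈ y → frob i x ≈ frob i y
  frob-cong i = ^-congˡ (p ^ i)

  frob-0 : ∀ x → frob 0 x ≈ x
  frob-0 x = *-identityʳ x

  frob-frob : ∀ i j x → frob j (frob i x) ≈ frob (i ℕ.+ j) x
  frob-frob i j x = trans (^-assocʳ x (p ^ i) (p ^ j)) (^-congʳ x (≡.sym (ℕ.^-distribˡ-+-* p i j)))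

  frob-suc : ∀ i x → frob (suc i) x ≈ frob i x ^ᴷ p
  frob-suc i x = trans (^-congʳ x (ℕ.*-comm p (p ^ i))) (sym (^-assocʳ x (p ^ i) p))

  frob-* : ∀ i x y → frob i (x * y) ≈ frob i x * frob i y
  frob-* i x y = ^-distrib-* x y (p ^ i)

  frob-+ : ∀ i x y → frob i (x + y) ≈ frob i x + frob i y
  frob-+ zero    x y = trans (frob-0 _) (sym (+-cong (frob-0 x) (frob-0 y)))
  frob-+ (suc i) x y = begin
    frob (suc i) (x + y)              ≈⟨ frob-suc i _ ⟩
    frob i (x + y) ^ᴷ p               ≈⟨ ^-congˡ p (frob-+ i x y) ⟩
    (frob i x + frob i y) ^ᴷ p        ≈⟨ freshman _ _ ⟩
    frob i x ^ᴷ p + frob i y ^ᴷ p     ≈⟨ sym (+-cong (frob-suc i x) (frob-suc i y)) ⟩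
    frob (suc i) x + frob (suc i) y   ∎

  frob-1 : ∀ i → frob i 1# ≈ 1#
  frob-1 i = 1^n≈1 (p ^ i)

  -- The exponent `p ^ i` does not reduce to a successor, so the value at 0# is obtained from
  -- additivity by cancellation.
  frob-zero : ∀ i → frob i 0# ≈ 0#
  frob-zero i = +-cancelˡ (frob i 0#) _ _ (trans (sym (frob-+ i 0# 0#)) (trans (frob-cong i (+-identityˡ 0#)) (sym (+-identityʳ _))))

  frob-difference : ∀ i x y → frob i (x - y) ≈ frob i x - frob i y
  frob-difference i x y = begin
    frob i (x - y)                            ≈⟨ solve 2 (λ a b → a := (a :+ b) :- b) refl _ (frob i y) ⟩
    (frob i (x - y) + frob i y) - frob i y    ≈⟨ +-congʳ (sym (frob-+ i _ _)) ⟩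
    frob i ((x - y) + y) - frob i y           ≈⟨ +-congʳ (frob-cong i (solve 2 (λ x y → (x :- y) :+ y := x) refl x y)) ⟩
    frob i x - frob i y                       ∎

-- Repeating powers, idempotents and finite Frobenius orbits.

module AlgebraicOverFp {k ℓ} (K : CommutativeRing k ℓ) (isField : IsField K) {p : ℕ} (pr : Prime p)
                       (char : HasCharacteristic K p) (algebraic : IsAlgebraicOverPrimeField K) where
  open CommutativeRingExtras K
  open CharacteristicP K pr char
  open IsDivisionRing isField
  open ≈-R

  private instance
    p≢0 : NonZero p
    p≢0 = prime⇒nonZero pr

  module PowerCodes (x : Carrier) where

    -- Horner's scheme for the sum of `f i` times x^i. Coefficients are naturals, so that sums and
    -- multiples are formed without reduction; residues modulo `p` appear only when a finite set of
    -- codes is needed.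
    val : ∀ m → (Fin m → ℕ) → Carrier
    val zero    f = 0#
    val (suc m) f = natK K (f zero) + x * val m (f ∘ suc)

    val-cong : ∀ m (f g : Fin m → ℕ) → (∀ i → natK K (f i) ≈ natK K (g i)) → val m f ≈ val m g
    val-cong zero    f g f≈g = refl
    val-cong (suc m) f g f≈g = +-cong (f≈g zero) (*-congˡ (val-cong m (f ∘ suc) (g ∘ suc) (f≈g ∘ suc)))

    val-zero : ∀ m {f : Fin m → ℕ} → (∀ i → natK K (f i) ≈ 0#) → val m f ≈ 0#
    val-zero zero    f≈0 = refl
    val-zero (suc m) f≈0 = trans (+-cong (f≈0 zero) (trans (*-congˡ (val-zero m (f≈0 ∘ suc))) (zeroʳ x))) (+-identityˡ 0#)

    val-+ : ∀ m (f g : Fin m → ℕ) → val m (λ i → f i ℕ.+ g i) ≈ val m f + val m g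
    val-+ zero    f g = sym (+-identityˡ 0#)
    val-+ (suc m) f g = trans (+-cong (natK-+ (f zero) (g zero)) (*-congˡ (val-+ m (f ∘ suc) (g ∘ suc))))
      (solve 5 (λ a b x u v → (a :+ b) :+ x :* (u :+ v) := (a :+ x :* u) :+ (b :+ x :* v)) refl _ _ _ _ _)

    val-* : ∀ m n (f : Fin m → ℕ) → val m (λ i → n ℕ.* f i) ≈ natK K n * val m f
    val-* zero    n f = sym (zeroʳ _)
    val-* (suc m) n f = trans (+-cong (natK-* n (f zero)) (*-congˡ (val-* m n (f ∘ suc))))
      (solve 4 (λ c a x u → c :* a :+ x :* (c :* u) := c :* (a :+ x :* u)) refl _ _ _ _)

    val-init-last : ∀ m (f : Fin (suc m) → ℕ) →
                    val (suc m) f ≈ val m (f ∘ inject₁) + natK K (f (fromℕ m)) * x ^ᴷ m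
    val-init-last zero    f = solve 2 (λ a x → a :+ x :* :0 := :0 :+ a :* :1) refl _ _
    val-init-last (suc m) f = trans (+-congˡ (*-congˡ (val-init-last m (f ∘ suc))))
      (solve 5 (λ a x u c y → a :+ x :* (u :+ c :* y) := (a :+ x :* u) :+ c :* (x :* y)) refl _ _ _ _ _)

    evalPoly≈val : ∀ ds → evalPoly K (List.map (natK K) ds) x ≈ val (List.length ds) (List.lookup ds)
    evalPoly≈val []       = refl
    evalPoly≈val (d ∷ ds) = +-congˡ (*-congˡ (evalPoly≈val ds))

    module _ {d : ℕ} (r : Fin (suc d) → ℕ) (x^d≈ : x ^ᴷ suc d ≈ val (suc d) r) where

      shift : (Fin (suc d) → ℕ) → Fin (suc (suc d)) → ℕ
      shift f zero    = 0
      shift f (suc i) = f i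

      -- Multiplication by `x` shifts the coefficients, and the overflow in degree `suc d` is
      -- rewritten by `x^d≈`.
      power-code : ∀ n → ∃[ f ] x ^ᴷ n ≈ val (suc d) f
      power-code zero    = (λ { zero → 1 ; (suc _) → 0 }) ,
        sym (trans (+-congˡ (*-congˡ (val-zero d λ _ → refl))) (solve 1 (λ x → (:1 :+ :0) :+ x :* :0 := :1) refl x))
      power-code (suc n) = let (f , eq) = power-code n; c = f (fromℕ d) in
        (λ i → shift f (inject₁ i) ℕ.+ c ℕ.* r i) , (begin
        x * x ^ᴷ n                                                ≈⟨ *-congˡ eq ⟩
        x * val (suc d) f                                         ≈⟨ sym (+-identityˡ _) ⟩
        val (suc (suc d)) (shift f)                               ≈⟨ val-init-last (suc d) (shift f) ⟩
        val (suc d) (shift f ∘ inject₁) + natK K c * x ^ᴷ suc d   ≈⟨ +-congˡ (*-congˡ x^d≈) ⟩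
        val (suc d) (shift f ∘ inject₁) + natK K c * val (suc d) r  ≈⟨ +-congˡ (sym (val-* (suc d) c r)) ⟩
        val (suc d) (shift f ∘ inject₁) + val (suc d) (λ i → c ℕ.* r i) ≈⟨ sym (val-+ (suc d) (shift f ∘ inject₁) (λ i → c ℕ.* r i)) ⟩
        val (suc d) (λ i → shift f (inject₁ i) ℕ.+ c ℕ.* r i)     ∎)

      power-code-% : ∀ n → ∃[ g ] x ^ᴷ n ≈ val (suc d) (toℕ {p} ∘ g)
      power-code-% n = let (f , eq) = power-code n in
        (λ i → fromℕ< (m%n<n (f i) p)) ,
        trans eq (val-cong (suc d) f (λ i → toℕ (fromℕ< (m%n<n (f i) p))) λ i → sym (trans
          (reflexive (≡.cong (natK K) (F.toℕ-fromℕ< (m%n<n (f i) p)))) (natK-% (f i))))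

      -- Pigeonhole: there are `p ^ suc d` codes, and one more exponent is tried. `φ` is left open
      -- because both consecutive exponents and powers of `p` are needed.
      repeated-power : (φ : ℕ → ℕ) → ∃₂ λ i j → i < j × x ^ᴷ φ i ≈ x ^ᴷ φ j
      repeated-power φ = toℕ i , toℕ j , i<j ,
        trans (proj₂ (code i)) (trans (val-cong (suc d) (toℕ ∘ proj₁ (code i)) (toℕ ∘ proj₁ (code j)) λ l → reflexive (≡.cong (natK K ∘ toℕ) (same l))) (sym (proj₂ (code j))))
        where
        code = λ (i : Fin (suc (p ^ suc d))) → power-code-% (φ (toℕ i))
        hole = F.pigeonhole (ℕ.n<1+n (p ^ suc d)) (λ i → funToFin (proj₁ (code i)))
        i = proj₁ hole
        j = proj₁ (proj₂ hole)
        i<j = proj₁ (proj₂ (proj₂ hole))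
        same : ∀ l → proj₁ (code i) l ≡ proj₁ (code j) l
        same l = ≡.trans (≡.sym (F.finToFun-funToFin (proj₁ (code i)) l))
                 (≡.trans (≡.cong (λ c → finToFun c l) (proj₂ (proj₂ (proj₂ hole)))) (F.finToFun-funToFin (proj₁ (code j)) l))

    -- Coefficients are naturals, so `p ∸ 1` stands for -1: together with `f i` the multiple
    -- `(p ∸ 1) * f i` makes a multiple of `p`.
    top-power : ∀ ds → evalPoly K (List.map (natK K) ds ++ 1# ∷ []) x ≈ 0# →
                x ^ᴷ List.length ds ≈ val (List.length ds) (λ i → (p ∸ 1) ℕ.* List.lookup ds i)
    top-power ds root = begin
      x ^ᴷ n                                    ≈⟨ solve 3 (λ y v w → y := w :+ ((v :+ :1 :* y) :- (w :+ v))) refl _ (val n f) _ ⟩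
      val n (λ i → (p ∸ 1) ℕ.* f i) + ((val n f + 1# * x ^ᴷ n) - (val n (λ i → (p ∸ 1) ℕ.* f i) + val n f))
        ≈⟨ +-congˡ (trans (+-cong val+x^n≈0 (-‿cong multiple≈0)) (-‿inverseʳ 0#)) ⟩
      val n (λ i → (p ∸ 1) ℕ.* f i) + 0#        ≈⟨ +-identityʳ _ ⟩
      val n (λ i → (p ∸ 1) ℕ.* f i)             ∎
      where
      n = List.length ds
      f = List.lookup ds
      val+x^n≈0 : val n f + 1# * x ^ᴷ n ≈ 0#
      val+x^n≈0 = trans (+-cong (sym (evalPoly≈val ds)) (*-congˡ (^-congʳ x (≡.sym (List.length-map (natK K) ds)))))
        (trans (sym (evalPoly-snoc (List.map (natK K) ds) 1# x)) root)
      multiple≈0 : val n (λ i → (p ∸ 1) ℕ.* f i) + val n f ≈ 0#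
      multiple≈0 = trans (sym (val-+ n (λ i → (p ∸ 1) ℕ.* f i) f)) (val-zero n λ i → natK-multiple (divides (f i)
        (≡.trans (ℕ.+-comm _ (f i)) (≡.trans (≡.cong (ℕ._* f i) (ℕ.suc-pred p)) (ℕ.*-comm p (f i))))))

  repeated-power : ∀ x (φ : ℕ → ℕ) → ∃₂ λ i j → i < j × x ^ᴷ φ i ≈ x ^ᴷ φ j
  repeated-power x φ with algebraic x
  -- The empty list stands for the constant polynomial 1.
  ... | []     , 1≈0  = ⊥-elim (nontrivial (trans (sym (trans (+-congˡ (zeroʳ x)) (+-identityʳ 1#))) 1≈0))
  ... | d ∷ ds , root = PowerCodes.repeated-power x {List.length ds} (λ i → (p ∸ 1) ℕ.* List.lookup (d ∷ ds) i) (PowerCodes.top-power x (d ∷ ds) root) φ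

  power-nonzero : ∀ {x} n → ¬ x ≈ 0# → ¬ x ^ᴷ n ≈ 0#
  power-nonzero         zero    x≉0 = nontrivial
  power-nonzero {x} (suc n) x≉0 x*xⁿ≈0 = power-nonzero n x≉0 (begin
    x ^ᴷ n              ≈⟨ sym (*-identityˡ _) ⟩
    1# * x ^ᴷ n         ≈⟨ *-congʳ (sym (proj₂ (proj₂ (inverse x x≉0)))) ⟩
    (y * x) * x ^ᴷ n    ≈⟨ *-assoc _ _ _ ⟩
    y * (x * x ^ᴷ n)    ≈⟨ *-congˡ x*xⁿ≈0 ⟩
    y * 0#              ≈⟨ zeroʳ y ⟩
    0#                  ∎)
    where y = proj₁ (inverse x x≉0)

  -- It is not known whether `x` is invertible, so nothing can be cancelled: the period `d` is only
  -- carried forward from exponent `a` on.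
  eventually-periodic : ∀ {x a d} → x ^ᴷ a ≈ x ^ᴷ (a ℕ.+ d) → ∀ m n → x ^ᴷ (a ℕ.+ m) ≈ x ^ᴷ ((a ℕ.+ m) ℕ.+ n ℕ.* d)
  eventually-periodic {x} {a} {d} eq m zero    = ^-congʳ x (≡.sym (ℕ.+-identityʳ (a ℕ.+ m)))
  eventually-periodic {x} {a} {d} eq m (suc n) = begin
    x ^ᴷ (a ℕ.+ m)                            ≈⟨ eventually-periodic {x} {a} {d} eq m n ⟩
    x ^ᴷ ((a ℕ.+ m) ℕ.+ n ℕ.* d)              ≡⟨ ≡.cong (x ^ᴷ_) (ℕ.+-assoc a m _) ⟩
    x ^ᴷ (a ℕ.+ (m ℕ.+ n ℕ.* d))              ≈⟨ ^-homo-* x a _ ⟩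
    x ^ᴷ a * x ^ᴷ (m ℕ.+ n ℕ.* d)             ≈⟨ *-congʳ eq ⟩
    x ^ᴷ (a ℕ.+ d) * x ^ᴷ (m ℕ.+ n ℕ.* d)     ≈⟨ sym (^-homo-* x (a ℕ.+ d) _) ⟩
    x ^ᴷ ((a ℕ.+ d) ℕ.+ (m ℕ.+ n ℕ.* d))      ≡⟨ ≡.cong (x ^ᴷ_) (rearrange (n ℕ.* d)) ⟩
    x ^ᴷ ((a ℕ.+ m) ℕ.+ (d ℕ.+ n ℕ.* d))      ∎
    where
    open Algebra.Properties.CommutativeSemigroup ℕ.+-commutativeSemigroup using (interchange)
    rearrange : ∀ e → (a ℕ.+ d) ℕ.+ (m ℕ.+ e) ≡ (a ℕ.+ m) ℕ.+ (d ℕ.+ e)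
    rearrange e = interchange a d m e

  -- The exponent is `suc a * suc d`. It is past the preperiod and a multiple of the period, so
  -- doubling it does not change the power.
  idempotent-power : ∀ {x} a d → x ^ᴷ suc a ≈ x ^ᴷ (suc a ℕ.+ suc d) →
                     ∃[ m ] x ^ᴷ suc m * x ^ᴷ suc m ≈ x ^ᴷ suc m
  idempotent-power {x} a d eq = a ℕ.+ e , (begin
    x ^ᴷ suc (a ℕ.+ e) * x ^ᴷ suc (a ℕ.+ e)             ≈⟨ sym (^-homo-* x (suc (a ℕ.+ e)) _) ⟩
    x ^ᴷ (suc (a ℕ.+ e) ℕ.+ suc (a ℕ.+ e))              ≡⟨ ≡.cong (λ n → x ^ᴷ (suc (a ℕ.+ e) ℕ.+ n)) multiple ⟩
    x ^ᴷ (suc (a ℕ.+ e) ℕ.+ suc a ℕ.* suc d)            ≈⟨ sym (eventually-periodic {x} {suc a} {suc d} eq e (suc a)) ⟩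
    x ^ᴷ suc (a ℕ.+ e)                                  ∎)
    where
    e = suc a ℕ.* d
    multiple : suc (a ℕ.+ e) ≡ suc a ℕ.* suc d
    multiple = ≡.sym (ℕ.*-suc (suc a) d)

  -- The idempotent `x * y` acts as a truth value for "x is nonzero" that is available without a
  -- decision.
  idempotent-multiple : ∀ x → ∃[ y ] (x * y) * (x * y) ≈ x * y × (x * y ≈ 0# → ¬ ¬ x ≈ 0#)
  idempotent-multiple x =
    -- Taking `suc` for `φ` makes the exponents positive, so that the idempotent power has a factor
    -- `x`.
    let (i , j , i<j , eq) = repeated-power x suc
        (m , idem) = idempotent-power i (j ∸ suc i)
          (trans eq (^-congʳ x (≡.cong suc (≡.trans (≡.sym (ℕ.m+[n∸m]≡n i<j)) (≡.sym (ℕ.+-suc i _))))))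
    in x ^ᴷ m , idem , λ xᵐ≈0 x≉0 → power-nonzero (suc m) x≉0 xᵐ≈0

  dot : ∀ {n} → (Fin n → Carrier) → (Fin n → Carrier) → Carrier
  dot a v = sum λ i → a i * v i

  -- Equality in K is not decidable, so a nonzero entry of a nonzero vector cannot be pointed at;
  -- but the entries span an ideal with an idempotent generator, which is 1 if it is not 0.
  idempotent-combination : ∀ n (v : Fin n → Carrier) →
    ∃[ a ] dot a v * dot a v ≈ dot a v × (dot a v ≈ 0# → ¬ ¬ (∀ i → v i ≈ 0#))
  idempotent-combination zero    v = (λ ()) , zeroˡ 0# , λ _ → return λ ()
  idempotent-combination (suc n) v = a , idem , vanish
    where
    v₀ = v zero
    y = proj₁ (idempotent-multiple v₀)
    e = v₀ * y
    ee≈e = proj₁ (proj₂ (idempotent-multiple v₀))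
    b = proj₁ (idempotent-combination n (v ∘ suc))
    t = dot b (v ∘ suc)
    tt≈t = proj₁ (proj₂ (idempotent-combination n (v ∘ suc)))
    a : Fin (suc n) → Carrier
    a zero    = y
    -- This makes the combination `e + (1# - e) * t`, the join of the idempotents `e` and `t`; it
    -- vanishes only if both do.
    a (suc i) = (1# - e) * b i
    a·v : dot a v ≈ e + (1# - e) * t
    a·v = +-cong (*-comm y v₀) (trans (sum-cong-≋ {n} λ i → *-assoc (1# - e) (b i) (v (suc i))) (sym (*-distribˡ-sum (1# - e) (λ i → b i * v (suc i)))))
    idem : dot a v * dot a v ≈ dot a v
    idem = begin
      dot a v * dot a v                                 ≈⟨ *-cong a·v a·v ⟩
      (e + (1# - e) * t) * (e + (1# - e) * t)           ≈⟨ solve 2 (λ e t → (e :+ (:1 :- e) :* t) :* (e :+ (:1 :- e) :* t) :=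
                                                             (e :+ (:1 :- e) :* t) :+ ((e :* e :- e) :* (:1 :- (t :+ t) :+ t :* t) :+ (:1 :- e) :* (t :* t :- t))) refl e t ⟩
      (e + (1# - e) * t) + ((e * e - e) * (1# - (t + t) + t * t) + (1# - e) * (t * t - t))
        ≈⟨ +-congˡ (+-cong (*-congʳ (x≈y⇒x-y≈0 ee≈e)) (*-congˡ (x≈y⇒x-y≈0 tt≈t))) ⟩
      (e + (1# - e) * t) + (0# * (1# - (t + t) + t * t) + (1# - e) * 0#)
        ≈⟨ solve 3 (λ s u w → s :+ (:0 :* u :+ w :* :0) := s) refl _ _ _ ⟩
      e + (1# - e) * t                                  ≈⟨ sym a·v ⟩
      dot a v                                           ∎
    vanish : dot a v ≈ 0# → ¬ ¬ (∀ i → v i ≈ 0#)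
    vanish av≈0 = do
      v₀≈0 ← proj₂ (proj₂ (idempotent-multiple v₀)) e≈0
      v≈0 ← proj₂ (proj₂ (idempotent-combination n (v ∘ suc))) t≈0
      return λ { zero → v₀≈0 ; (suc i) → v≈0 i }
      where
      s≈0 : e + (1# - e) * t ≈ 0#
      s≈0 = trans (sym a·v) av≈0
      e≈0 : e ≈ 0#
      e≈0 = begin
        e                                               ≈⟨ solve 2 (λ e t → e := e :* (e :+ (:1 :- e) :* t) :+ (e :* e :- e) :* (t :- :1)) refl e t ⟩
        e * (e + (1# - e) * t) + (e * e - e) * (t - 1#) ≈⟨ +-cong (*-congˡ s≈0) (*-congʳ (x≈y⇒x-y≈0 ee≈e)) ⟩
        e * 0# + 0# * (t - 1#)                          ≈⟨ solve 2 (λ e t → e :* :0 :+ :0 :* t := :0) refl _ _ ⟩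
        0#                                              ∎
      t≈0 : t ≈ 0#
      t≈0 = begin
        t                                               ≈⟨ solve 2 (λ e t → t := (e :+ (:1 :- e) :* t) :+ e :* (t :- :1)) refl e t ⟩
        (e + (1# - e) * t) + e * (t - 1#)               ≈⟨ +-cong s≈0 (*-congʳ e≈0) ⟩
        0# + 0# * (t - 1#)                              ≈⟨ solve 1 (λ t → :0 :+ :0 :* t := :0) refl _ ⟩
        0#                                              ∎

  -- An idempotent that is not zero can be cancelled against itself, hence is 1#. This turns a
  -- negative hypothesis into a positive witness.
  unimodular : ∀ {n} {v : Fin n → Carrier} → ¬ (∀ i → v i ≈ 0#) → ∃[ a ] dot a v ≈ 1#
  unimodular {n} {v} v≉0 =
    let (a , idem , vanish) = idempotent-combination n v
        t = dot a v
        (s , _ , st≈1) = inverse t λ t≈0 → vanish t≈0 v≉0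
    in a , (begin
      t             ≈⟨ sym (*-identityˡ t) ⟩
      1# * t        ≈⟨ *-congʳ (sym st≈1) ⟩
      (s * t) * t   ≈⟨ *-assoc s t t ⟩
      s * (t * t)   ≈⟨ *-congˡ idem ⟩
      s * t         ≈⟨ st≈1 ⟩
      1#            ∎)

  -- Replaces division by a nonzero entry, which cannot be located: `s` equals `s * dot a v`, a
  -- combination of the products `s * v i`.
  annihilator-zero : ∀ {n s} {v : Fin n → Carrier} → ¬ (∀ i → v i ≈ 0#) → (∀ i → s * v i ≈ 0#) → s ≈ 0#
  annihilator-zero {n} {s} {v} v≉0 sv≈0 = let (a , av≈1) = unimodular v≉0 in begin
    s                             ≈⟨ sym (*-identityʳ s) ⟩
    s * 1#                        ≈⟨ *-congˡ (sym av≈1) ⟩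
    s * dot a v                   ≈⟨ *-distribˡ-sum s (λ i → a i * v i) ⟩
    sum (λ i → s * (a i * v i))   ≈⟨ sum-zero (λ i → trans (solve 3 (λ s a v → s :* (a :* v) := a :* (s :* v)) refl _ _ _)
                                                       (trans (*-congˡ (sv≈0 i)) (zeroʳ _))) ⟩
    0#                            ∎

  frob-nonzero : ∀ i {x} → ¬ x ≈ 0# → ¬ frob i x ≈ 0#
  frob-nonzero i = power-nonzero (p ^ i)

  -- From x^(p^i) = x^(p^j), the difference `frob (j ∸ i) x - x` is sent to zero by `frob i`, and a
  -- field has no nonzero nilpotents.
  frob-fixed : ∀ x → ¬ ¬ (∃[ m ] frob (suc m) x ≈ x)
  frob-fixed x with repeated-power x (p ^_)
  ... | i , j , i<j , eq = do
    yes z≈0 ← ¬¬-excluded-middle {A = frob (j ∸ i) x - x ≈ 0#}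
      where no z≉0 → ⊥-elim (frob-nonzero i z≉0 (trans (frob-difference i _ _)
                       (x≈y⇒x-y≈0 (trans (frob-frob (j ∸ i) i x) (trans (^-congʳ x (≡.cong (p ^_) (ℕ.m∸n+n≡m (ℕ.<⇒≤ i<j)))) (sym eq))))))
    return (j ∸ suc i , trans (^-congʳ x (≡.cong (p ^_) (≡.sym (ℕ.+-∸-assoc 1 i<j)))) (x-y≈0⇒x≈y z≈0))

  frob-fixed-multiple : ∀ {x} m → frob m x ≈ x → ∀ n → frob (n ℕ.* m) x ≈ x
  frob-fixed-multiple m eq zero    = frob-0 _
  frob-fixed-multiple m eq (suc n) =
    trans (sym (frob-frob m (n ℕ.* m) _)) (trans (frob-cong (n ℕ.* m) eq) (frob-fixed-multiple m eq n))

  frob-fixed-all : ∀ xs → ¬ ¬ (∃[ m ] All (λ x → frob (suc m) x ≈ x) xs)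
  frob-fixed-all []       = return (0 , [])
  frob-fixed-all (x ∷ xs) = do
    m , fixed  ← frob-fixed x
    n , fixeds ← frob-fixed-all xs
    -- One less than the product of the two periods: `suc (m + n * suc m)` is `suc n * suc m`.
    return (m ℕ.+ n ℕ.* suc m ,
      frob-fixed-multiple (suc m) fixed (suc n) ∷
      All.map (λ {y} eq → trans (^-congʳ y (≡.cong (p ^_) (ℕ.*-comm (suc n) (suc m))))
                          (frob-fixed-multiple (suc n) eq (suc m))) fixeds)

-- Linear algebra over a division ring.

module DivisionRingModule {r ℓr m ℓm} {D : Ring r ℓr} (isDivisionRing : IsDivisionRing D) (W : LeftModule D m ℓm) where
  open Ring D hiding (zero)
  open LeftModule W
  open IsDivisionRing isDivisionRing
  open Algebra.Properties.Ring D using (-0#≈0#; -‿distribˡ-*)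
  open Algebra.Properties.Semiring.Sum semiring using (sum; sum-cong-≋; *-distribʳ-sum; ∑-distrib-+; sum-replicate-zero; sum-remove)
  open Algebra.Properties.CommutativeMonoid.Sum +ᴹ-commutativeMonoid using ()
    renaming (sum to sumᵂ; sum-cong-≋ to sumᵂ-cong; ∑-comm to ∑ᵂ-comm; ∑-distrib-+ to ∑ᵂ-distrib-+; sum-replicate-zero to sumᵂ-replicate-zero)
  module ≈-R = Relation.Binary.Reasoning.Setoid setoid
  module ≈ᴹ-R = Relation.Binary.Reasoning.Setoid ≈ᴹ-setoid

  record IsSubmodule {s} (P : Carrierᴹ → Set s) : Set (r ⊔ m ⊔ ℓm ⊔ s) where
    field
      resp   : ∀ {u v} → u ≈ᴹ v → P u → P v
      zero-∈ : P 0ᴹ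
      +-∈    : ∀ {u v} → P u → P v → P (u +ᴹ v)
      *-∈    : ∀ a {u} → P u → P (a *ₗ u)

    combination : ∀ {u v w} → P u → P v → InSpan2 W u v w → P w
    combination Pu Pv (s , t , w≈) = resp (≈ᴹ-sym w≈) (+-∈ (*-∈ s Pu) (*-∈ t Pv))

  solve-for : ∀ {s t u v x y} → x ≈ᴹ s *ₗ u +ᴹ t *ₗ v → y * s ≈ 1# → u ≈ᴹ y *ₗ x +ᴹ (- (y * t)) *ₗ v
  solve-for {s} {t} {u} {v} {x} {y} x≈ ys≈1 = begin
    u                                                       ≈⟨ +ᴹ-identityʳ u ⟨
    u +ᴹ 0ᴹ                                                 ≈⟨ +ᴹ-cong (*ₗ-identityˡ u) (*ₗ-zeroˡ v) ⟨
    1# *ₗ u +ᴹ 0# *ₗ v                                      ≈⟨ +ᴹ-cong (*ₗ-cong ys≈1 ≈ᴹ-refl) (*ₗ-cong (-‿inverseʳ (y * t)) ≈ᴹ-refl) ⟨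
    (y * s) *ₗ u +ᴹ (y * t - y * t) *ₗ v                    ≈⟨ +ᴹ-cong (*ₗ-assoc y s u) (*ₗ-distribʳ v (y * t) (- (y * t))) ⟩
    y *ₗ (s *ₗ u) +ᴹ ((y * t) *ₗ v +ᴹ (- (y * t)) *ₗ v)     ≈⟨ +ᴹ-cong ≈ᴹ-refl (+ᴹ-cong (*ₗ-assoc y t v) ≈ᴹ-refl) ⟩
    y *ₗ (s *ₗ u) +ᴹ (y *ₗ (t *ₗ v) +ᴹ (- (y * t)) *ₗ v)    ≈⟨ +ᴹ-assoc _ _ _ ⟨
    (y *ₗ (s *ₗ u) +ᴹ y *ₗ (t *ₗ v)) +ᴹ (- (y * t)) *ₗ v    ≈⟨ +ᴹ-cong (*ₗ-distribˡ y (s *ₗ u) (t *ₗ v)) ≈ᴹ-refl ⟨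
    y *ₗ (s *ₗ u +ᴹ t *ₗ v) +ᴹ (- (y * t)) *ₗ v             ≈⟨ +ᴹ-cong (*ₗ-cong refl x≈) ≈ᴹ-refl ⟨
    y *ₗ x +ᴹ (- (y * t)) *ₗ v                              ∎
    where open ≈ᴹ-R

  swap-span : ∀ {u v x} → InSpan2 W u v x → InSpan2 W v u x
  swap-span (s , t , x≈) = t , s , ≈ᴹ-trans x≈ (+ᴹ-comm _ _)

  combination-zero : ∀ {s t u v x} → x ≈ᴹ s *ₗ u +ᴹ t *ₗ v → s ≈ 0# → t ≈ 0# → x ≈ᴹ 0ᴹ
  combination-zero {u = u} {v} x≈ s≈0 t≈0 = ≈ᴹ-trans x≈ (≈ᴹ-trans
    (+ᴹ-cong (≈ᴹ-trans (*ₗ-cong s≈0 ≈ᴹ-refl) (*ₗ-zeroˡ u)) (≈ᴹ-trans (*ₗ-cong t≈0 ≈ᴹ-refl) (*ₗ-zeroˡ v))) (+ᴹ-identityʳ 0ᴹ))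

  module _ {s} {P : Carrierᴹ → Set s} (isSubmodule : IsSubmodule P) where
    open IsSubmodule isSubmodule

    -- Steinitz exchange. As `s` is invertible, `x` replaces `u`, and `y` becomes a combination of
    -- `x` and `v`. Its coefficient `b` at `v` is nonzero, since otherwise `y` would be zero or
    -- proportional to `x`; so `v` is recovered, and then `u`.
    exchange-pivot : ∀ {u v x y} → ((s , _) : InSpan2 W u v x) → ¬ s ≈ 0# → InSpan2 W u v y →
                     ¬ y ≈ᴹ 0ᴹ → ¬ Proportionalᴹ W x y → P x → P y → ¬ ¬ (P u × P v)
    exchange-pivot {u} {v} {x} {y} (s , t , x≈) s≉0 (s′ , t′ , y≈) y≉0 x∦y Px Py =
      ¬¬-excluded-middle {A = b ≈ 0#} >>= λ where
        (yes b≈0) → ⊥-elim (x∦y (s′ * i , (λ s′i≈0 → y≉0 (combination-zero y≈ix+bv s′i≈0 b≈0)) ,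
          ≈ᴹ-trans y≈ix+bv (≈ᴹ-trans (+ᴹ-cong ≈ᴹ-refl (≈ᴹ-trans (*ₗ-cong b≈0 ≈ᴹ-refl) (*ₗ-zeroˡ v))) (+ᴹ-identityʳ _))))
        (no b≉0) →
          let (j , _ , jb≈1) = inverse b b≉0
              Pv = combination Py Px (_ , _ , solve-for (≈ᴹ-trans y≈ix+bv (+ᴹ-comm _ _)) jb≈1)
          in return (combination Px Pv (_ , _ , u≈) , Pv)
      where
      open ≈ᴹ-R
      i = proj₁ (inverse s s≉0)
      u≈ : u ≈ᴹ i *ₗ x +ᴹ (- (i * t)) *ₗ v
      u≈ = solve-for x≈ (proj₂ (proj₂ (inverse s s≉0)))
      b = s′ * - (i * t) + t′
      y≈ix+bv : y ≈ᴹ (s′ * i) *ₗ x +ᴹ b *ₗ v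
      y≈ix+bv = begin
        y                                                           ≈⟨ y≈ ⟩
        s′ *ₗ u +ᴹ t′ *ₗ v                                          ≈⟨ +ᴹ-cong (*ₗ-cong refl u≈) ≈ᴹ-refl ⟩
        s′ *ₗ (i *ₗ x +ᴹ (- (i * t)) *ₗ v) +ᴹ t′ *ₗ v               ≈⟨ +ᴹ-cong (*ₗ-distribˡ s′ _ _) ≈ᴹ-refl ⟩
        (s′ *ₗ (i *ₗ x) +ᴹ s′ *ₗ ((- (i * t)) *ₗ v)) +ᴹ t′ *ₗ v     ≈⟨ +ᴹ-assoc _ _ _ ⟩
        s′ *ₗ (i *ₗ x) +ᴹ (s′ *ₗ ((- (i * t)) *ₗ v) +ᴹ t′ *ₗ v)     ≈⟨ +ᴹ-cong (*ₗ-assoc s′ i x) (+ᴹ-cong (*ₗ-assoc s′ _ v) ≈ᴹ-refl) ⟨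
        (s′ * i) *ₗ x +ᴹ ((s′ * - (i * t)) *ₗ v +ᴹ t′ *ₗ v)         ≈⟨ +ᴹ-cong ≈ᴹ-refl (*ₗ-distribʳ v _ _) ⟨
        (s′ * i) *ₗ x +ᴹ b *ₗ v                                     ∎

    -- Two distinct points of a projective line span it. Applied in K^(n+1) to the lines of the
    -- geometry, and in the embedding space to their images.
    line-closed : ∀ {u v x y z} → InSpan2 W u v x → InSpan2 W u v y → ¬ x ≈ᴹ 0ᴹ → ¬ y ≈ᴹ 0ᴹ →
                  ¬ Proportionalᴹ W x y → P x → P y → InSpan2 W u v z → ¬ ¬ P z
    line-closed {u} {v} x∈@(s , t , x≈) y∈ x≉0 y≉0 x∦y Px Py z∈ = do
      Pu , Pv ← ¬¬-excluded-middle {A = s ≈ 0#} >>= λ where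
        (no s≉0)  → exchange-pivot x∈ s≉0 y∈ y≉0 x∦y Px Py
        (yes s≈0) → exchange-pivot (swap-span x∈) (λ t≈0 → x≉0 (combination-zero x≈ s≈0 t≈0)) (swap-span y∈) y≉0 x∦y Px Py
                    >>= λ (Pv , Pu) → return (Pu , Pv)
      return (combination Pu Pv z∈)

  sumᴹ≡sum : ∀ k (f : Fin k → Carrierᴹ) → sumᴹ W k f ≡ sumᵂ f
  sumᴹ≡sum zero    f = ≡.refl
  sumᴹ≡sum (suc k) f = ≡.cong (f zero +ᴹ_) (sumᴹ≡sum k (f ∘ suc))

  Σᵂ : ∀ {k} → (Fin k → Carrier) → (Fin k → Carrierᴹ) → Carrierᴹ
  Σᵂ c b = sumᵂ λ i → c i *ₗ b i

  *ₗ-distrib-sum : ∀ {k} a (f : Fin k → Carrierᴹ) → a *ₗ sumᵂ f ≈ᴹ sumᵂ (λ i → a *ₗ f i)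
  *ₗ-distrib-sum {zero}  a f = *ₗ-zeroʳ a
  *ₗ-distrib-sum {suc k} a f = ≈ᴹ-trans (*ₗ-distribˡ a _ _) (+ᴹ-cong ≈ᴹ-refl (*ₗ-distrib-sum a (f ∘ suc)))

  sum-distrib-*ₗ : ∀ {k} (c : Fin k → Carrier) u → sum c *ₗ u ≈ᴹ sumᵂ (λ i → c i *ₗ u)
  sum-distrib-*ₗ {zero}  c u = *ₗ-zeroˡ u
  sum-distrib-*ₗ {suc k} c u = ≈ᴹ-trans (*ₗ-distribʳ u _ _) (+ᴹ-cong ≈ᴹ-refl (sum-distrib-*ₗ (c ∘ suc) u))

  Span : ∀ {n} → (Fin n → Carrierᴹ) → Carrierᴹ → Set _
  Span {n} b w = Σ (Fin n → Carrier) λ c → w ≈ᴹ Σᵂ c b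

  Span-isSubmodule : ∀ {n} (b : Fin n → Carrierᴹ) → IsSubmodule (Span b)
  Span-isSubmodule {n} b = record
    { resp   = λ { u≈v (c , u≈) → c , ≈ᴹ-trans (≈ᴹ-sym u≈v) u≈ }
    ; zero-∈ = (λ _ → 0#) , ≈ᴹ-sym (≈ᴹ-trans (sumᵂ-cong {n} λ i → *ₗ-zeroˡ (b i)) (sumᵂ-replicate-zero n))
    ; +-∈    = λ { (c , u≈) (d , v≈) → (λ i → c i + d i) , ≈ᴹ-trans (+ᴹ-cong u≈ v≈)
        (≈ᴹ-sym (≈ᴹ-trans (sumᵂ-cong {n} λ i → *ₗ-distribʳ (b i) (c i) (d i)) (∑ᵂ-distrib-+ (λ i → c i *ₗ b i) (λ i → d i *ₗ b i)))) }
    ; *-∈    = λ { a (c , u≈) → (λ i → a * c i) , ≈ᴹ-trans (*ₗ-cong refl u≈)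
        (≈ᴹ-trans (*ₗ-distrib-sum a (λ i → c i *ₗ b i)) (≈ᴹ-sym (sumᵂ-cong {n} λ i → *ₗ-assoc a (c i) (b i)))) }
    }

  Span-generator : ∀ {n} (b : Fin n → Carrierᴹ) i → Span b (b i)
  Span-generator {suc n} b zero    = (λ { zero → 1# ; (suc _) → 0# }) , ≈ᴹ-sym (≈ᴹ-trans
    (+ᴹ-cong (*ₗ-identityˡ _) (≈ᴹ-trans (sumᵂ-cong {n} λ i → *ₗ-zeroˡ (b (suc i))) (sumᵂ-replicate-zero n))) (+ᴹ-identityʳ _))
  Span-generator {suc n} b (suc i) = let (c , b≈) = Span-generator (b ∘ suc) i in
    (λ { zero → 0# ; (suc j) → c j }) , ≈ᴹ-sym (≈ᴹ-trans (+ᴹ-cong (*ₗ-zeroˡ _) (≈ᴹ-sym b≈)) (+ᴹ-identityˡ _))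

  -- Gaussian elimination on the first column; more rows than columns force a nontrivial left
  -- relation between the rows.
  relation : ∀ n k → n < k → (A : Fin k → Fin n → Carrier) →
             ¬ ¬ (Σ (Fin k → Carrier) λ c → ¬ (∀ i → c i ≈ 0#) × ∀ j → sum (λ i → c i * A i j) ≈ 0#)
  relation zero    (suc k) _         A = return ((λ _ → 1#) , (λ 1≈0 → nontrivial (1≈0 zero)) , λ ())
  relation (suc n) (suc k) (s≤s n<k) A = ¬¬-excluded-middle {A = ∀ i → A i zero ≈ 0#} >>= λ where
      (yes column≈0) → do
        c , c≉0 , cA≈0 ← relation n (suc k) (ℕ.m≤n⇒m≤1+n n<k) (λ i j → A i (suc j))
        return (c , c≉0 , λ where
          zero    → trans (sum-cong-≋ {suc k} λ i → trans (*-congˡ (column≈0 i)) (zeroʳ (c i))) (sum-replicate-zero (suc k))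
          (suc j) → cA≈0 j)
      (no column≉0) → do
        i₀ , pivot≉0 ← ¬∀⇒¬¬∃¬ column≉0
        let y = proj₁ (inverse (A i₀ zero) pivot≉0)
            -- These multiples of the pivot row clear the first column of the other rows. They
            -- multiply from the left, as D need not be commutative.
            μ = λ i → A (punchIn i₀ i) zero * y
            B = λ i j → A (punchIn i₀ i) j - μ i * A i₀ j
            B₀≈0 : ∀ i → B i zero ≈ 0#
            B₀≈0 i = trans (+-congˡ (-‿cong (trans (*-assoc _ _ _)
              (trans (*-congˡ (proj₂ (proj₂ (inverse (A i₀ zero) pivot≉0)))) (*-identityʳ _))))) (-‿inverseʳ _)
        c , c≉0 , cB≈0 ← relation n k n<k (λ i j → B i (suc j))
        -- The coefficient of the pivot row is chosen so that `d` combines the rows of `A` into what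
        -- `c` makes of the reduced rows `B`.
        let d₀ = - sum (λ i → c i * μ i)
            d = Vec.insertAt c i₀ d₀
            total : ∀ j → sum (λ i → d i * A i j) ≈ sum (λ i → c i * B i j)
            total j = begin
              sum (λ i → d i * A i j)
                ≈⟨ sum-remove {i = i₀} (λ i → d i * A i j) ⟩
              d i₀ * A i₀ j + sum (λ i → d (punchIn i₀ i) * A (punchIn i₀ i) j)
                ≈⟨ +-cong (*-congʳ (reflexive (Vec.insertAt-lookup c i₀ d₀)))
                          (sum-cong-≋ {k} λ i → *-congʳ (reflexive (Vec.insertAt-punchIn c i₀ d₀ i))) ⟩
              d₀ * A i₀ j + sum (λ i → c i * A (punchIn i₀ i) j)
                ≈⟨ +-comm _ _ ⟩
              sum (λ i → c i * A (punchIn i₀ i) j) + d₀ * A i₀ j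
                ≈⟨ +-congˡ (trans (sym (-‿distribˡ-* _ _)) (trans (-‿cong (*-distribʳ-sum (A i₀ j) (λ i → c i * μ i))) (sum-neg (λ i → (c i * μ i) * A i₀ j)))) ⟩
              sum (λ i → c i * A (punchIn i₀ i) j) + sum (λ i → - ((c i * μ i) * A i₀ j))
                ≈⟨ ∑-distrib-+ (λ i → c i * A (punchIn i₀ i) j) (λ i → - ((c i * μ i) * A i₀ j)) ⟨
              sum (λ i → c i * A (punchIn i₀ i) j - (c i * μ i) * A i₀ j)
                ≈⟨ sum-cong-≋ {k} (λ i → trans (+-congˡ (trans (-‿cong (*-assoc _ _ _)) (-‿distribʳ-* _ _))) (sym (distribˡ _ _ _))) ⟩
              sum (λ i → c i * B i j) ∎
        return (d , (λ d≈0 → c≉0 λ i → trans (reflexive (≡.sym (Vec.insertAt-punchIn c i₀ d₀ i))) (d≈0 (punchIn i₀ i))) , λ where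
          zero    → trans (total zero) (trans (sum-cong-≋ {k} λ i → trans (*-congˡ (B₀≈0 i)) (zeroʳ (c i))) (sum-replicate-zero k))
          (suc j) → trans (total (suc j)) (cB≈0 j))
    where
    open ≈-R
    open Algebra.Properties.Ring D using (-‿distribʳ-*; -‿+-comm)
    sum-neg : ∀ {k} (f : Fin k → Carrier) → - sum f ≈ sum (λ i → - f i)
    sum-neg {zero}  f = -0#≈0#
    sum-neg {suc k} f = trans (sym (-‿+-comm _ _)) (+-congˡ (sum-neg (f ∘ suc)))

  -- With `k` larger than `n`, the coefficient rows of the `vs` would satisfy a `relation`, which
  -- carries over to the `vs` themselves.
  independent-≤-spanning : ∀ {n k} (b : Fin n → Carrierᴹ) (vs : Fin k → Carrierᴹ) →
                           LinearlyIndependent W k vs → (∀ i → ¬ ¬ Span b (vs i)) → k ≤ n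
  independent-≤-spanning {n} {k} b vs independent spanned = decidable-stable (k ℕ.≤? n) (¬¬-pull-Fin spanned >>= λ spans k≰n →
    let A = λ i → proj₁ (spans i) in
    relation n k (ℕ.≰⇒> k≰n) A λ (c , c≉0 , cA≈0) →
      c≉0 (independent c (≈ᴹ-trans (≈ᴹ-reflexive (sumᴹ≡sum k (λ i → c i *ₗ vs i))) (begin
        sumᵂ (λ i → c i *ₗ vs i)                          ≈⟨ sumᵂ-cong {k} (λ i → ≈ᴹ-trans (*ₗ-cong refl (proj₂ (spans i)))
                                                               (*ₗ-distrib-sum (c i) (λ j → A i j *ₗ b j))) ⟩
        sumᵂ (λ i → sumᵂ (λ j → c i *ₗ (A i j *ₗ b j)))   ≈⟨ ∑ᵂ-comm (λ i j → c i *ₗ (A i j *ₗ b j)) ⟩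
        sumᵂ (λ j → sumᵂ (λ i → c i *ₗ (A i j *ₗ b j)))   ≈⟨ sumᵂ-cong {n} (λ j → ≈ᴹ-sym (≈ᴹ-trans
                                                               (sum-distrib-*ₗ (λ i → c i * A i j) (b j))
                                                               (sumᵂ-cong {k} λ i → *ₗ-assoc (c i) (A i j) (b j)))) ⟩
        sumᵂ (λ j → sum (λ i → c i * A i j) *ₗ b j)       ≈⟨ sumᵂ-cong {n} (λ j → ≈ᴹ-trans (*ₗ-cong (cA≈0 j) ≈ᴹ-refl) (*ₗ-zeroˡ (b j))) ⟩
        sumᵂ {n} (λ _ → 0ᴹ)                               ≈⟨ sumᵂ-replicate-zero n ⟩
        0ᴹ                                                ∎))))
    where open ≈ᴹ-R

-- Equality is tested on `Q` only, which divides out the values off `Q` while keeping plain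
-- functions as carrier. A full `Q` gives coordinate spaces; omitting one matrix entry gives a model
-- of the trace zero matrices.
functions : ∀ {a q k ℓ} (K : CommutativeRing k ℓ) (A : Set a) (Q : A → Set q) →
            LeftModule (CommutativeRing.ring K) (a ⊔ k) (a ⊔ q ⊔ ℓ)
functions K A Q = record
  { Carrierᴹ = A → Carrier
  ; _≈ᴹ_ = λ f g → ∀ x → Q x → f x ≈ g x
  ; _+ᴹ_ = λ f g x → f x + g x
  ; _*ₗ_ = λ c f x → c * f x
  ; 0ᴹ = λ _ → 0#
  ; -ᴹ_ = λ f x → - f x
  ; isLeftModule = record
    { isLeftSemimodule = record
      { +ᴹ-isCommutativeMonoid = record
        { isMonoid = record
          { isSemigroup = record
            { isMagma = record
              { isEquivalence = record
                { refl = λ _ _ → refl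
                ; sym = λ eq x q → sym (eq x q)
                ; trans = λ eq₁ eq₂ x q → trans (eq₁ x q) (eq₂ x q)
                }
              ; ∙-cong = λ eq₁ eq₂ x q → +-cong (eq₁ x q) (eq₂ x q)
              }
            ; assoc = λ _ _ _ _ _ → +-assoc _ _ _
            }
          ; identity = (λ _ _ _ → +-identityˡ _) , (λ _ _ _ → +-identityʳ _)
          }
        ; comm = λ _ _ _ _ → +-comm _ _
        }
      ; isPreleftSemimodule = record
        { *ₗ-cong = λ c≈d eq x q → *-cong c≈d (eq x q)
        ; *ₗ-zeroˡ = λ _ _ _ → zeroˡ _
        ; *ₗ-distribʳ = λ _ _ _ _ _ → distribʳ _ _ _
        ; *ₗ-identityˡ = λ _ _ _ → *-identityˡ _
        ; *ₗ-assoc = λ _ _ _ _ _ → *-assoc _ _ _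
        ; *ₗ-zeroʳ = λ _ _ _ → zeroʳ _
        ; *ₗ-distribˡ = λ _ _ _ _ _ → distribˡ _ _ _
        }
      }
    ; -ᴹ‿cong = λ eq x q → -‿cong (eq x q)
    ; -ᴹ‿inverse = (λ _ _ _ → -‿inverseˡ _) , (λ _ _ _ → -‿inverseʳ _)
    }
  }
  where open CommutativeRing K

module FunctionSubmodule {a q k ℓ} (K : CommutativeRing k ℓ) (isField : IsField K) (A : Set a) (Q : A → Set q) where
  open CommutativeRingExtras K using (Carrier; sum)
  open DivisionRingModule isField (functions K A Q) public using (IsSubmodule)

  sum-∈ : ∀ {s} {P : (A → Carrier) → Set s} → IsSubmodule P → ∀ m (u : Fin m → A → Carrier) → (∀ i → P (u i)) →
          P (λ x → sum (λ i → u i x))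
  sum-∈ sub zero    u Pu = IsSubmodule.zero-∈ sub
  sum-∈ sub (suc m) u Pu = IsSubmodule.+-∈ sub (Pu zero) (sum-∈ sub m (u ∘ suc) (Pu ∘ suc))

-- Special roots and simple subfields of the closure.

module AlgebraicClosure {k ℓ} (K : CommutativeRing k ℓ) {p : ℕ} (pr : Prime p) (closure : IsAlgebraicClosureOfFp K p) where
  open IsAlgebraicClosureOfFp closure
  open CommutativeRingExtras K
  open CharacteristicP K pr characteristic
  open AlgebraicOverFp K isField pr characteristic algebraic
  open IsDivisionRing isField
  open ≈-R

  -- Algebraic closedness speaks of coefficient lists. Writing q as `suc (suc e)` provides the
  -- number of zeros in the list for X^q - X - 1, and the exponent `suc e` as q - 1.
  1<p^suc : ∀ m → ∃[ e ] p ^ suc m ≡ suc (suc e)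
  1<p^suc m with p ^ suc m | ℕ.^-monoʳ-< p (ℕ.nonTrivial⇒n>1 p {{prime⇒nonTrivial pr}}) {0} {suc m} (s≤s z≤n)
  ... | suc zero    | s≤s ()
  ... | suc (suc e) | _      = e , ≡.refl

  evalPoly-zeros : ∀ n x → evalPoly K (List.replicate n 0#) x ≈ 0#
  evalPoly-zeros zero    x = refl
  evalPoly-zeros (suc n) x = trans (+-congˡ (*-congˡ (evalPoly-zeros n x))) (trans (+-identityˡ _) (zeroʳ x))

  root : ∀ a d → ∃[ y ] y ^ᴷ suc d ≈ a
  -- The polynomial X^(d+1) - a.
  root a d = let (y , eq) = algClosed (- a) (List.replicate d 0#) in y , (begin
    y ^ᴷ suc d                                              ≡⟨ ≡.cong (λ e → y ^ᴷ suc e) (List.length-replicate d) ⟨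
    y ^ᴷ suc (List.length (List.replicate d 0#))            ≈⟨ solve 2 (λ a t → t := a :+ (((:- a) :+ :0) :+ :1 :* t)) refl a _ ⟩
    a + ((- a + 0#) + 1# * y ^ᴷ suc (List.length (List.replicate d 0#)))
      ≈⟨ +-congˡ (+-congʳ (+-congˡ (trans (*-congˡ (evalPoly-zeros d y)) (zeroʳ y)))) ⟨
    a + (evalPoly K (- a ∷ List.replicate d 0#) y + 1# * y ^ᴷ suc (List.length (List.replicate d 0#)))
      ≈⟨ +-congˡ (trans (sym (evalPoly-snoc (- a ∷ List.replicate d 0#) 1# y)) eq) ⟩
    a + 0#                                                  ≈⟨ +-identityʳ a ⟩
    a                                                       ∎)

  artin-schreier : ∀ m → ∃[ a ] frob (suc m) a ≈ a + 1#
  artin-schreier m with 1<p^suc m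
  -- The polynomial X^q - X - 1.
  ... | e , q≡ = let (a , eq) = algClosed (- 1#) (- 1# ∷ List.replicate e 0#)
                     l = List.length (List.replicate e 0#) in a , (begin
    a ^ᴷ (p ^ suc m)              ≡⟨ ≡.cong (a ^ᴷ_) (≡.trans q≡ (≡.cong (2 ℕ.+_) (≡.sym (List.length-replicate e {0#})))) ⟩
    a ^ᴷ suc (suc l)              ≈⟨ solve 2 (λ a t → t := (a :+ :1) :+ (((:- :1) :+ a :* ((:- :1) :+ :0)) :+ :1 :* t)) refl a _ ⟩
    (a + 1#) + ((- 1# + a * (- 1# + 0#)) + 1# * a ^ᴷ suc (suc l))
      ≈⟨ +-congˡ (+-congʳ (+-congˡ (*-congˡ (+-congˡ (trans (*-congˡ (evalPoly-zeros e a)) (zeroʳ a)))))) ⟨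
    (a + 1#) + (evalPoly K (- 1# ∷ - 1# ∷ List.replicate e 0#) a + 1# * a ^ᴷ suc (suc l))
      ≈⟨ +-congˡ (trans (sym (evalPoly-snoc (- 1# ∷ - 1# ∷ List.replicate e 0#) 1# a)) eq) ⟩
    (a + 1#) + 0#                 ≈⟨ +-identityʳ _ ⟩
    a + 1#                        ∎)

  -- The subfield F_p(c), as an inductive closure so that statements about all its elements can be
  -- proved constructor by constructor.
  data Generated (c : Carrier) : Carrier → Set (k ⊔ ℓ) where
    generator : Generated c c
    one       : Generated c 1#
    minus-one : Generated c (- 1#)
    add       : ∀ {a b} → Generated c a → Generated c b → Generated c (a + b)
    mul       : ∀ {a b} → Generated c a → Generated c b → Generated c (a * b)
    inv       : ∀ {a b} → a * b ≈ 1# → Generated c a → Generated c b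
    resp      : ∀ {a b} → a ≈ b → Generated c a → Generated c b

  Generated-trans : ∀ {c b a} → Generated c b → Generated b a → Generated c a
  Generated-trans b∈ generator    = b∈
  Generated-trans b∈ one          = one
  Generated-trans b∈ minus-one    = minus-one
  Generated-trans b∈ (add x y)    = add (Generated-trans b∈ x) (Generated-trans b∈ y)
  Generated-trans b∈ (mul x y)    = mul (Generated-trans b∈ x) (Generated-trans b∈ y)
  Generated-trans b∈ (inv eq x)   = inv eq (Generated-trans b∈ x)
  Generated-trans b∈ (resp eq x)  = resp eq (Generated-trans b∈ x)

  Generated-minus : ∀ {c a b} → Generated c a → Generated c b → Generated c (a - b)
  Generated-minus a∈ b∈ = resp (solve 2 (λ a b → a :+ (:- :1) :* b := a :- b) refl _ _) (add a∈ (mul minus-one b∈))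

  Generated-power : ∀ {c a} n → Generated c a → Generated c (a ^ᴷ n)
  Generated-power zero    a∈ = one
  Generated-power (suc n) a∈ = mul a∈ (Generated-power n a∈)

  -- With F the q-th power map fixing a and b, and y a root of y^(q-1) = a, the element c = b + y
  -- has F c - c = (a - 1) y and F (F c) - F c = a (a - 1) y.
  primitive-element : ∀ a b → ¬ ¬ (∃[ c ] Generated c a × Generated c b)
  primitive-element a b = do
    -- The elements 0 and 1 lie in every subfield, so for them `b` itself is a generator. Otherwise
    -- `y` and `a - 1#` can be inverted.
    no a≉0 ← ¬¬-excluded-middle {A = a ≈ 0#}
      where yes a≈0 → return (b , resp (trans (-‿inverseʳ 1#) (sym a≈0)) (Generated-minus one one) , generator)
    no a-1≉0 ← ¬¬-excluded-middle {A = a - 1# ≈ 0#}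
      where yes a-1≈0 → return (b , resp (sym (x-y≈0⇒x≈y a-1≈0)) one , generator)
    m , (Fa≈a ∷ Fb≈b ∷ []) ← frob-fixed-all (a ∷ b ∷ [])
    return (generate a≉0 a-1≉0 m Fa≈a Fb≈b)
    where
    generate : ¬ a ≈ 0# → ¬ a - 1# ≈ 0# → ∀ m → frob (suc m) a ≈ a → frob (suc m) b ≈ b → ∃[ c ] Generated c a × Generated c b
    generate a≉0 a-1≉0 m Fa≈a Fb≈b = c , a∈ , resp (solve 2 (λ b y → (b :+ y) :- y := b) refl b y) (Generated-minus generator y∈)
      where
      F = frob (suc m)
      e = proj₁ (1<p^suc m)
      y = proj₁ (root a e)
      c = b + y
      Fy≈ay : F y ≈ a * y
      Fy≈ay = trans (^-congʳ y (proj₂ (1<p^suc m))) (trans (*-comm y _) (*-congʳ (proj₂ (root a e))))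
      y≉0 : ¬ y ≈ 0#
      y≉0 y≈0 = a≉0 (trans (sym (proj₂ (root a e))) (trans (*-congʳ y≈0) (zeroˡ _)))
      Fc≈ : F c ≈ b + a * y
      Fc≈ = trans (frob-+ (suc m) b y) (+-cong Fb≈b Fy≈ay)
      FFc≈ : F (F c) ≈ b + a * (a * y)
      FFc≈ = trans (frob-cong (suc m) Fc≈) (trans (frob-+ (suc m) b (a * y))
        (+-cong Fb≈b (trans (frob-* (suc m) a y) (*-cong Fa≈a Fy≈ay))))
      [a-1]y∈ : Generated c ((a - 1#) * y)
      [a-1]y∈ = resp (trans (+-congʳ Fc≈) (solve 3 (λ a b y → (b :+ a :* y) :- (b :+ y) := (a :- :1) :* y) refl a b y))
        (Generated-minus (Generated-power (p ^ suc m) generator) generator)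
      a[a-1]y∈ : Generated c (a * ((a - 1#) * y))
      a[a-1]y∈ = resp (trans (+-cong FFc≈ (-‿cong Fc≈))
                        (solve 3 (λ a b y → (b :+ a :* (a :* y)) :- (b :+ a :* y) := a :* ((a :- :1) :* y)) refl a b y))
        (Generated-minus (Generated-power (p ^ suc m) (Generated-power (p ^ suc m) generator)) (Generated-power (p ^ suc m) generator))
      i = proj₁ (inverse (a - 1#) a-1≉0)
      j = proj₁ (inverse y y≉0)
      [a-1]i≈1 = proj₁ (proj₂ (inverse (a - 1#) a-1≉0))
      yj≈1 = proj₁ (proj₂ (inverse y y≉0))
      [a-1]y*ij≈1 : ((a - 1#) * y) * (i * j) ≈ 1#
      [a-1]y*ij≈1 = trans (solve 4 (λ s y i j → (s :* y) :* (i :* j) := (s :* i) :* (y :* j)) refl _ _ _ _)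
        (trans (*-cong [a-1]i≈1 yj≈1) (*-identityˡ 1#))
      -- The second difference divided by the first is `a`; dividing the first by `a - 1#` then
      -- isolates `y`.
      a∈ : Generated c a
      a∈ = resp (trans (*-assoc _ _ _) (trans (*-congˡ [a-1]y*ij≈1) (*-identityʳ a))) (mul a[a-1]y∈ (inv [a-1]y*ij≈1 [a-1]y∈))
      y∈ : Generated c y
      y∈ = resp (trans (solve 3 (λ s y i → (s :* y) :* i := (s :* i) :* y) refl _ _ _) (trans (*-congʳ [a-1]i≈1) (*-identityˡ y)))
        (mul [a-1]y∈ (inv [a-1]i≈1 (Generated-minus a∈ one)))

  -- The extra element `a` carries along the generator already found for earlier flags.
  common-generator : ∀ m (u : Fin m → Carrier) a → ¬ ¬ (∃[ c ] Generated c a × (∀ i → Generated c (u i)))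
  common-generator zero    u a = return (a , generator , λ ())
  common-generator (suc m) u a = do
    b , a∈b , u∈b   ← common-generator m (u ∘ suc) a
    c , u₀∈c , b∈c ← primitive-element (u zero) b
    return (c , Generated-trans b∈c a∈b , λ { zero → u₀∈c ; (suc i) → Generated-trans b∈c (u∈b i) })

-- The pairing of functionals and vectors.

module Pairing {k ℓ} (K : CommutativeRing k ℓ) (n : ℕ) where
  open CommutativeRingExtras K

  V : Set k
  V = Vect K n

  ⟨_,_⟩ : V → V → Carrier
  ⟨_,_⟩ = ⟪_,_⟫ K n

  sumK≡sum : ∀ j (f : Fin j → Carrier) → sumK K n j f ≡ sum f
  sumK≡sum zero    f = ≡.refl
  sumK≡sum (suc j) f = ≡.cong (f zero +_) (sumK≡sum j (f ∘ suc))

  ⟨⟩≈sum : ∀ f v → ⟨ f , v ⟩ ≈ sum (λ i → f i * v i)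
  ⟨⟩≈sum f v = reflexive (sumK≡sum (suc n) (λ i → f i * v i))

  ⟨⟩-cong : ∀ f g v w → (∀ i → f i ≈ g i) → (∀ i → v i ≈ w i) → ⟨ f , v ⟩ ≈ ⟨ g , w ⟩
  ⟨⟩-cong f g v w f≈g v≈w =
    trans (⟨⟩≈sum f v) (trans (sum-cong-≋ {suc n} λ i → *-cong (f≈g i) (v≈w i)) (sym (⟨⟩≈sum g w)))

  ⟨⟩-congʳ : ∀ f v w → (∀ i → v i ≈ w i) → ⟨ f , v ⟩ ≈ ⟨ f , w ⟩
  ⟨⟩-congʳ f v w = ⟨⟩-cong f f v w (λ _ → refl)

  ⟨⟩-comm : ∀ f v → ⟨ f , v ⟩ ≈ ⟨ v , f ⟩
  ⟨⟩-comm f v = trans (⟨⟩≈sum f v) (trans (sum-cong-≋ {suc n} λ i → *-comm (f i) (v i)) (sym (⟨⟩≈sum v f)))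

  ⟨⟩-+ʳ : ∀ f v w → ⟨ f , (λ i → v i + w i) ⟩ ≈ ⟨ f , v ⟩ + ⟨ f , w ⟩
  ⟨⟩-+ʳ f v w = trans (⟨⟩≈sum f (λ i → v i + w i)) (trans (sum-cong-≋ {suc n} λ i → distribˡ (f i) (v i) (w i))
    (trans (∑-distrib-+ (λ i → f i * v i) (λ i → f i * w i)) (sym (+-cong (⟨⟩≈sum f v) (⟨⟩≈sum f w)))))

  ⟨⟩-*ʳ : ∀ f c v → ⟨ f , (λ i → c * v i) ⟩ ≈ c * ⟨ f , v ⟩
  ⟨⟩-*ʳ f c v = trans (⟨⟩≈sum f (λ i → c * v i)) (trans (sum-cong-≋ {suc n} λ i → solve 3 (λ f c v → f :* (c :* v) := c :* (f :* v)) refl (f i) c (v i))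
    (trans (sym (*-distribˡ-sum c (λ i → f i * v i))) (sym (*-congˡ (⟨⟩≈sum f v)))))

  ⟨⟩-+ˡ : ∀ f g v → ⟨ (λ i → f i + g i) , v ⟩ ≈ ⟨ f , v ⟩ + ⟨ g , v ⟩
  ⟨⟩-+ˡ f g v = trans (⟨⟩-comm (λ i → f i + g i) v) (trans (⟨⟩-+ʳ v f g) (+-cong (⟨⟩-comm v f) (⟨⟩-comm v g)))

  ⟨⟩-*ˡ : ∀ c f v → ⟨ (λ i → c * f i) , v ⟩ ≈ c * ⟨ f , v ⟩
  ⟨⟩-*ˡ c f v = trans (⟨⟩-comm (λ i → c * f i) v) (trans (⟨⟩-*ʳ v c f) (*-congˡ (⟨⟩-comm v f)))

  ⟨⟩-zeroʳ : ∀ f v → (∀ i → v i ≈ 0#) → ⟨ f , v ⟩ ≈ 0#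
  ⟨⟩-zeroʳ f v v≈0 = trans (⟨⟩≈sum f v) (sum-zero λ i → trans (*-congˡ (v≈0 i)) (zeroʳ (f i)))

  ⟨⟩-zeroˡ : ∀ f v → (∀ i → f i ≈ 0#) → ⟨ f , v ⟩ ≈ 0#
  ⟨⟩-zeroˡ f v f≈0 = trans (⟨⟩-comm f v) (⟨⟩-zeroʳ v f f≈0)

  𝕍 : LeftModule ring k ℓ
  𝕍 = functions K (Fin (suc n)) (λ _ → ⊤)

-- Proportional vectors, and subspaces cut out by bilinear relations.

module Proportionality {k ℓ} (K : CommutativeRing k ℓ) (isField : IsField K) (n : ℕ) where
  open CommutativeRingExtras K
  open IsDivisionRing isField
  open Pairing K n
  open DivisionRingModule isField 𝕍 public using (IsSubmodule; line-closed)

  *-nonzero : ∀ {x y} → ¬ x ≈ 0# → ¬ y ≈ 0# → ¬ x * y ≈ 0#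
  *-nonzero {x} {y} x≉0 y≉0 xy≈0 = let (i , xi≈1 , ix≈1) = inverse x x≉0 in
    y≉0 (trans (sym (*-identityˡ y)) (trans (*-congʳ (sym ix≈1)) (trans (*-assoc i x y) (trans (*-congˡ xy≈0) (zeroʳ i)))))

  inverse-nonzero : ∀ {x i} → x * i ≈ 1# → ¬ i ≈ 0#
  inverse-nonzero xi≈1 i≈0 = nontrivial (trans (sym xi≈1) (trans (*-congˡ i≈0) (zeroʳ _)))

  _∥_ : V → V → Set _
  _∥_ = ProportionalV K n

  ≈⇒∥ : ∀ {u v} → (∀ i → v i ≈ u i) → u ∥ v
  ≈⇒∥ eq = 1# , nontrivial , λ i → trans (eq i) (sym (*-identityˡ _))

  ∥-sym : ∀ {u v} → u ∥ v → v ∥ u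
  ∥-sym (c , c≉0 , v≈) = let (i , ci≈1 , ic≈1) = inverse c c≉0 in
    i , inverse-nonzero ci≈1 , λ j → sym (trans (*-congˡ (v≈ j)) (trans (sym (*-assoc i c _)) (trans (*-congʳ ic≈1) (*-identityˡ _))))

  ∥-trans : ∀ {u v w} → u ∥ v → v ∥ w → u ∥ w
  ∥-trans (c , c≉0 , v≈) (d , d≉0 , w≈) = d * c , *-nonzero d≉0 c≉0 , λ i →
    trans (w≈ i) (trans (*-congˡ (v≈ i)) (sym (*-assoc d c _)))

  Proportionalᴹ⇒∥ : ∀ {u v} → Proportionalᴹ 𝕍 u v → u ∥ v
  Proportionalᴹ⇒∥ (c , c≉0 , v≈) = c , c≉0 , λ i → v≈ i tt

  comb∥⇒InSpan2 : ∀ {g h x} → (∃ λ s → ∃ λ t → combV K n s g t h ∥ x) → InSpan2 𝕍 g h x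
  comb∥⇒InSpan2 (s , t , d , _ , x≈) = d * s , d * t , λ i _ →
    trans (x≈ i) (solve 5 (λ d s g t h → d :* (s :* g :+ t :* h) := (d :* s) :* g :+ (d :* t) :* h) refl _ _ _ _ _)

  module BilinearSubspace {r} (R : V → V → Set r)
           (Rᵛ : ∀ v → IsSubmodule (R v)) (Rᶠ : ∀ f → IsSubmodule (λ v → R v f)) where
    module Rᵛ v = IsSubmodule (Rᵛ v)
    module Rᶠ f = IsSubmodule (Rᶠ f)
    open GrPoint

    -- The double negation absorbs the case distinctions of `line-closed`; `Lift` reaches the
    -- universe that `IsSubspace` prescribes.
    S : GrPoint K n → Set (k ⊔ r)
    S x = Lift k (¬ ¬ R (vec x) (fun x))

    R-∥ : ∀ {v w f} → v ∥ w → R v f → R w f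
    R-∥ {f = f} (c , _ , w≈) r = Rᶠ.resp f (λ i _ → sym (w≈ i)) (Rᶠ.*-∈ f c r)

    ∥-R : ∀ {v f g} → f ∥ g → R v f → R v g
    ∥-R {v} (c , _ , g≈) r = Rᵛ.resp v (λ i _ → sym (g≈ i)) (Rᵛ.*-∈ v c r)

    -- Along a pencil only the functional moves, along a flat only the vector, so separate linearity
    -- suffices. Distinct points of the line agree in the fixed component up to a scalar, hence are
    -- not proportional in the moving one.
    S-closed : ∀ (L : GrLine K n) x y z → ¬ _≃G_ K n x y →
               _∈G_ K n x L → _∈G_ K n y L → S x → S y → _∈G_ K n z L → S z
    S-closed (pencil v g h _ _ _ _) x y z x≄y (vx , x∈) (vy , y∈) (lift Sx) (lift Sy) (vz , z∈) = lift (do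
      Rx ← Sx
      Ry ← Sy
      Rz ← line-closed (Rᵛ v) (comb∥⇒InSpan2 x∈) (comb∥⇒InSpan2 y∈)
             (λ x≈0 → fun≢0 x λ i → x≈0 i tt) (λ y≈0 → fun≢0 y λ i → y≈0 i tt)
             (λ x∥y → x≄y (∥-trans (∥-sym vx) vy , Proportionalᴹ⇒∥ x∥y))
             (R-∥ (∥-sym vx) Rx) (R-∥ (∥-sym vy) Ry) (comb∥⇒InSpan2 z∈)
      return (R-∥ vz Rz))
    S-closed (flat f u w _ _ _ _) x y z x≄y (fx , x∈) (fy , y∈) (lift Sx) (lift Sy) (fz , z∈) = lift (do
      Rx ← Sx
      Ry ← Sy
      Rz ← line-closed (Rᶠ f) (comb∥⇒InSpan2 x∈) (comb∥⇒InSpan2 y∈)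
             (λ x≈0 → vec≢0 x λ i → x≈0 i tt) (λ y≈0 → vec≢0 y λ i → y≈0 i tt)
             (λ x∥y → x≄y (Proportionalᴹ⇒∥ x∥y , ∥-trans (∥-sym fx) fy))
             (∥-R (∥-sym fx) Rx) (∥-R (∥-sym fy) Ry) (comb∥⇒InSpan2 z∈)
      return (∥-R fz Rz))

    S-resp : ∀ {x y} → _≃G_ K n x y → S x → S y
    S-resp (v∥ , f∥) (lift Sx) = lift (Sx >>= λ Rx → return (∥-R f∥ (R-∥ v∥ Rx)))

-- Infinite generating rank.

module GeneratingRank {k ℓ} (K : CommutativeRing k ℓ) {p : ℕ} (pr : Prime p) (closure : IsAlgebraicClosureOfFp K p) (n : ℕ) where
  open IsAlgebraicClosureOfFp closure
  open CommutativeRingExtras K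
  open CharacteristicP K pr characteristic
  open AlgebraicOverFp K isField pr characteristic algebraic using (frob-fixed-all; frob-fixed-multiple)
  open AlgebraicClosure K pr closure using (artin-schreier)
  open IsDivisionRing isField
  open Pairing K (suc n)
  open Proportionality K isField (suc n)
  open GrPoint

  module Conjugates (m : ℕ) where
    F : ℕ → V → V
    F j v i = frob (j ℕ.* m) (v i)

    R : V → V → Set ℓ
    R v f = ∀ j → ⟨ f , F j v ⟩ ≈ 0#

    Rᵛ : ∀ v → IsSubmodule (R v)
    Rᵛ v = record
      { resp   = λ {u} {w} u≈w r j → trans (⟨⟩-cong w u (F j v) (F j v) (λ i → sym (u≈w i tt)) (λ _ → refl)) (r j)
      ; zero-∈ = λ j → ⟨⟩-zeroˡ (λ _ → 0#) (F j v) λ _ → refl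
      ; +-∈    = λ {f} {g} r s j → trans (⟨⟩-+ˡ f g (F j v)) (trans (+-cong (r j) (s j)) (+-identityˡ 0#))
      ; *-∈    = λ a {f} r j → trans (⟨⟩-*ˡ a f (F j v)) (trans (*-congˡ (r j)) (zeroʳ a))
      }

    -- A scalar comes out as its own conjugate, which does not disturb vanishing, so semilinearity
    -- in `v` is enough.
    Rᶠ : ∀ f → IsSubmodule (λ v → R v f)
    Rᶠ f = record
      { resp   = λ {u} {v} u≈v r j → trans (⟨⟩-congʳ f (F j v) (F j u) λ i → frob-cong (j ℕ.* m) (sym (u≈v i tt))) (r j)
      ; zero-∈ = λ j → ⟨⟩-zeroʳ f (F j λ _ → 0#) λ _ → frob-zero (j ℕ.* m)
      ; +-∈    = λ {u} {v} r s j → trans (⟨⟩-congʳ f _ (λ i → F j u i + F j v i) λ i → frob-+ (j ℕ.* m) (u i) (v i))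
                   (trans (⟨⟩-+ʳ f (F j u) (F j v)) (trans (+-cong (r j) (s j)) (+-identityˡ 0#)))
      ; *-∈    = λ a {u} r j → trans (⟨⟩-congʳ f _ (λ i → frob (j ℕ.* m) a * F j u i) λ i → frob-* (j ℕ.* m) a (u i))
                   (trans (⟨⟩-*ʳ f (frob (j ℕ.* m) a) (F j u)) (trans (*-congˡ (r j)) (zeroʳ _)))
      }

    open BilinearSubspace R Rᵛ Rᶠ public

    S-isSubspace : IsSubspace (Gr1n K (suc n)) S
    S-isSubspace = record { resp = λ {x} {y} → S-resp {x} {y} ; closed = S-closed }

    -- A vector with coordinates fixed by the q-th power map equals all its conjugates, so every
    -- condition reduces to incidence.
    rational : ∀ x → (∀ i → frob m (vec x i) ≈ vec x i) → S x
    rational x fixed = lift (return λ j →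
      trans (⟨⟩-congʳ (fun x) (F j (vec x)) (vec x) λ i → frob-fixed-multiple m (fixed i) j) (incident x))

  coordinates : List (GrPoint K (suc n)) → List Carrier
  coordinates []       = []
  coordinates (x ∷ xs) = List.tabulate (vec x) ++ coordinates xs

  fixed-coordinates : ∀ {q} {P : Carrier → Set q} xs → All P (coordinates xs) → All (λ x → ∀ i → P (vec x i)) xs
  fixed-coordinates []       _  = []
  fixed-coordinates (x ∷ xs) ps = All.tabulate⁻ (All.++⁻ˡ (List.tabulate (vec x)) ps) ∷
                                  fixed-coordinates xs (All.++⁻ʳ (List.tabulate (vec x)) ps)

  infinite : HasInfiniteGeneratingRank (Gr1n K (suc n))
  infinite xs generates =
    frob-fixed-all (coordinates xs) λ (m , fixed) →
      let open Conjugates (suc m)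
          (a , Fa≈a+1) = artin-schreier m
          v : V
          v = λ { zero → 1# ; (suc zero) → a ; (suc (suc _)) → 0# }
          f : V
          f = λ { zero → - a ; (suc zero) → 1# ; (suc (suc _)) → 0# }
          pairing : ∀ w → ⟨ f , w ⟩ ≈ w (suc zero) - a * w zero
          pairing w = trans (+-congˡ (+-congˡ (trans (reflexive (sumK≡sum n (λ i → 0# * w (suc (suc i))))) (sum-zero {n} λ i → zeroˡ _))))
            (solve 3 (λ a w₀ w₁ → (:- a) :* w₀ :+ (:1 :* w₁ :+ :0) := w₁ :- a :* w₀) refl a _ _)
          x = flag v f (λ v≈0 → nontrivial (v≈0 zero)) (λ f≈0 → nontrivial (f≈0 (suc zero)))
                (trans (pairing v) (solve 1 (λ a → a :- a :* :1 := :0) refl a))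
      in lower (generates S S-isSubspace
           (All.map (λ {y} → rational y) (fixed-coordinates xs fixed)) x) λ r →
         -- The condition `r 1` on the first conjugate fails: there the pairing is a^q - a = 1.
         nontrivial (begin
           1#                                          ≈⟨ solve 1 (λ a → :1 := (a :+ :1) :- a :* :1) refl a ⟩
           (a + 1#) - a * 1#                           ≈⟨ +-cong Fa≈a+1 (-‿cong (*-congˡ (frob-1 (suc m)))) ⟨
           frob (suc m) a - a * frob (suc m) 1#        ≈⟨ pairing (frob (suc m) ∘ v) ⟨
           ⟨ f , frob (suc m) ∘ v ⟩                    ≈⟨ ⟨⟩-congʳ f (frob (suc m) ∘ v) (F 1 v) (λ i → ^-congʳ (v i) (≡.cong (p ^_) (≡.sym (ℕ.*-identityˡ (suc m))))) ⟩
           ⟨ f , F 1 v ⟩                               ≈⟨ r 1 ⟩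
           0#                                          ∎)
    where open ≈-R

-- Bilinearity of the relation defined by a subspace of the geometry.

module SubspaceRelation {k ℓ} (K : CommutativeRing k ℓ) {p : ℕ} (pr : Prime p) (closure : IsAlgebraicClosureOfFp K p) (n : ℕ) where
  open IsAlgebraicClosureOfFp closure
  open CommutativeRingExtras K
  open AlgebraicOverFp K isField pr characteristic algebraic using (annihilator-zero)
  open IsDivisionRing isField
  open Pairing K n
  open Proportionality K isField n
  open GrPoint

  private
    _≃_ = _≃G_ K n
    _∈_ = _∈G_ K n

  module Pencils {s} (S : GrPoint K n → Set s) (stable : ∀ x → ¬ ¬ S x → S x) (S-resp : ∀ x y → x ≃ y → S x → S y)
           (pencil-closed : ∀ v g h v≉0 ind gv hv x y z → ¬ x ≃ y →
             x ∈ pencil v g h v≉0 ind gv hv → y ∈ pencil v g h v≉0 ind gv hv →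
             S x → S y → z ∈ pencil v g h v≉0 ind gv hv → S z) where

    -- Quantifying over all flags with these coordinates avoids deciding whether `v` and `f` are
    -- zero. If one of them is, no such flag exists and the clause is vacuous, which puts 0 into the
    -- submodules.
    T : V → V → Set _
    T v f = ⟨ f , v ⟩ ≈ 0# × (∀ x → (∀ i → vec x i ≈ v i) → (∀ i → fun x i ≈ f i) → S x)

    -- The scalars may vanish: a flag `x` over the scaled pair is given, and its existence shows
    -- that `v`, `f`, `c` and `d` are nonzero.
    T-scale : ∀ {v w f g} c d → T v f → (∀ i → w i ≈ c * v i) → (∀ i → g i ≈ d * f i) → T w g
    T-scale {v} {w} {f} {g} c d (fv≈0 , mem) w≈ g≈ = gw≈0 , λ x x≈w x≈g →
      let xv≈ = λ i → trans (x≈w i) (w≈ i)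
          xf≈ = λ i → trans (x≈g i) (g≈ i)
          y = flag v f
                (λ v≈0 → vec≢0 x λ i → trans (xv≈ i) (trans (*-congˡ (v≈0 i)) (zeroʳ c)))
                (λ f≈0 → fun≢0 x λ i → trans (xf≈ i) (trans (*-congˡ (f≈0 i)) (zeroʳ d))) fv≈0
      in S-resp y x
           ((c , (λ c≈0 → vec≢0 x λ i → trans (xv≈ i) (trans (*-congʳ c≈0) (zeroˡ _))) , xv≈) ,
            (d , (λ d≈0 → fun≢0 x λ i → trans (xf≈ i) (trans (*-congʳ d≈0) (zeroˡ _))) , xf≈))
           (mem y (λ _ → refl) (λ _ → refl))
      where
      gw≈0 : ⟨ g , w ⟩ ≈ 0#
      gw≈0 = trans (⟨⟩-cong g (λ i → d * f i) w (λ i → c * v i) g≈ w≈)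
        (trans (⟨⟩-*ˡ d f (λ i → c * v i)) (trans (*-congˡ (trans (⟨⟩-*ʳ f c v) (trans (*-congˡ fv≈0) (zeroʳ c)))) (zeroʳ d)))

    -- The 2-by-2 minors express dependence of `f` and `g` by equations alone. If not all vanish,
    -- `annihilator-zero` yields independence in its positive form; if all vanish and `f` is
    -- nonzero, `g` is a multiple of `f`.
    minors : V → V → Fin (suc n) → Fin (suc n) → Carrier
    minors f g i j = f i * g j - f j * g i

    matrix-annihilator-zero : ∀ {s} {M : Fin (suc n) → Fin (suc n) → Carrier} →
                              ¬ (∀ i j → M i j ≈ 0#) → (∀ i j → s * M i j ≈ 0#) → s ≈ 0#
    matrix-annihilator-zero {s} {M} M≉0 sM≈0 = annihilator-zero {v = λ l → entry (remQuot {suc n} (suc n) l)}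
      (λ M≈0 → M≉0 λ i j → trans (reflexive (≡.cong entry (≡.sym (F.remQuot-combine {suc n} i j)))) (M≈0 (combine i j)))
      (λ l → sM≈0 _ _)
      where
      entry : Fin (suc n) × Fin (suc n) → Carrier
      entry (i , j) = M i j

    -- Cramer's rule: eliminating one unknown from equations `i` and `j` shows that each of `s` and
    -- `t` annihilates the minor.
    independent : ∀ f g → ¬ (∀ i j → minors f g i j ≈ 0#) → IndependentV K n f g
    independent f g minors≉0 s t eq =
      matrix-annihilator-zero minors≉0 (λ i j → trans
        (solve 6 (λ s t fi fj gi gj → s :* (fi :* gj :- fj :* gi) := (s :* fi :+ t :* gi) :* gj :- (s :* fj :+ t :* gj) :* gi) refl s t (f i) (f j) (g i) (g j))
        (cancel (eq i) (eq j))) ,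
      matrix-annihilator-zero minors≉0 (λ i j → trans
        (solve 6 (λ s t fi fj gi gj → t :* (fi :* gj :- fj :* gi) := (s :* fj :+ t :* gj) :* fi :- (s :* fi :+ t :* gi) :* fj) refl s t (f i) (f j) (g i) (g j))
        (cancel (eq j) (eq i)))
      where
      cancel : ∀ {x y a b} → x ≈ 0# → y ≈ 0# → x * a - y * b ≈ 0#
      cancel {a = a} {b} x≈0 y≈0 = trans (+-cong (*-congʳ x≈0) (-‿cong (*-congʳ y≈0))) (solve 2 (λ a b → :0 :* a :- :0 :* b := :0) refl a b)

    -- For independent `f` and `g`, the sum lies on the pencil line joining the two flags. In the
    -- dependent case, `h` is `g` when `f` is zero and a multiple of `f` otherwise.
    T-+ : ∀ {v f g h} → T v f → T v g → (∀ i → h i ≈ f i + g i) → T v h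
    T-+ {v} {f} {g} {h} Tf@(fv≈0 , fmem) Tg@(gv≈0 , gmem) h≈ = hv≈0 , λ x x≈v x≈h → stable x (mem x x≈v x≈h)
      where
      hv≈0 : ⟨ h , v ⟩ ≈ 0#
      hv≈0 = trans (⟨⟩-cong h (λ i → f i + g i) v v h≈ (λ _ → refl)) (trans (⟨⟩-+ˡ f g v) (trans (+-cong fv≈0 gv≈0) (+-identityˡ 0#)))
      mem : ∀ x → (∀ i → vec x i ≈ v i) → (∀ i → fun x i ≈ h i) → ¬ ¬ S x
      mem x x≈v x≈h = do
        yes minors≈0 ← ¬¬-excluded-middle {A = ∀ i j → minors f g i j ≈ 0#}
          where no minors≉0 →
                  let v≉0 = λ v≈0 → vec≢0 x λ i → trans (x≈v i) (v≈0 i)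
                      f≉0 = λ f≈0 → minors≉0 λ i j → trans (+-cong (*-congʳ (f≈0 i)) (-‿cong (*-congʳ (f≈0 j))))
                                                       (solve 2 (λ a b → :0 :* a :- :0 :* b := :0) refl (g j) (g i))
                      g≉0 = λ g≈0 → minors≉0 λ i j → trans (+-cong (*-congˡ (g≈0 j)) (-‿cong (*-congˡ (g≈0 i))))
                                                       (solve 2 (λ a b → a :* :0 :- b :* :0 := :0) refl (f i) (f j))
                      a = flag v f v≉0 f≉0 fv≈0
                      b = flag v g v≉0 g≉0 gv≈0
                  in return (pencil-closed v f g v≉0 (independent f g minors≉0) fv≈0 gv≈0 a b x
                       (λ (_ , c , _ , g≈cf) → minors≉0 λ i j →
                         trans (+-cong (*-congˡ (g≈cf j)) (-‿cong (*-congˡ (g≈cf i))))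
                               (solve 3 (λ c a b → a :* (c :* b) :- b :* (c :* a) := :0) refl c (f i) (f j)))
                       (≈⇒∥ (λ _ → refl) , 1# , 0# , ≈⇒∥ λ i → solve 2 (λ a b → a := :1 :* a :+ :0 :* b) refl (f i) (g i))
                       (≈⇒∥ (λ _ → refl) , 0# , 1# , ≈⇒∥ λ i → solve 2 (λ a b → b := :0 :* a :+ :1 :* b) refl (f i) (g i))
                       (fmem a (λ _ → refl) (λ _ → refl)) (gmem b (λ _ → refl) (λ _ → refl))
                       (≈⇒∥ x≈v , 1# , 1# , ≈⇒∥ λ i → trans (x≈h i) (trans (h≈ i)
                         (solve 2 (λ a b → a :+ b := :1 :* a :+ :1 :* b) refl (f i) (g i)))))
        no f≉0 ← ¬¬-excluded-middle {A = ∀ i → f i ≈ 0#}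
          where yes f≈0 → return (gmem x x≈v λ i → trans (x≈h i) (trans (h≈ i) (trans (+-congʳ (f≈0 i)) (+-identityˡ _))))
        i , fi≉0 ← ¬∀⇒¬¬∃¬ f≉0
        let (r , fi*r≈1 , _) = inverse (f i) fi≉0
            open ≈-R
            h≈cf : ∀ j → h j ≈ (1# + g i * r) * f j
            h≈cf j = begin
              h j                                       ≈⟨ h≈ j ⟩
              f j + g j                                 ≈⟨ +-congˡ (trans (sym (*-identityˡ _)) (*-congʳ (sym fi*r≈1))) ⟩
              f j + (f i * r) * g j                     ≈⟨ solve 5 (λ fi fj gi gj r → fj :+ (fi :* r) :* gj :=
                                                             (:1 :+ gi :* r) :* fj :+ r :* (fi :* gj :- fj :* gi)) refl (f i) (f j) (g i) (g j) r ⟩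
              (1# + g i * r) * f j + r * minors f g i j ≈⟨ +-congˡ (trans (*-congˡ (minors≈0 i j)) (zeroʳ r)) ⟩
              (1# + g i * r) * f j + 0#                 ≈⟨ +-identityʳ _ ⟩
              (1# + g i * r) * f j                      ∎
        return (proj₂ (T-scale {w = v} {g = h} 1# (1# + g i * r) Tf (λ j → sym (*-identityˡ _)) h≈cf) x x≈v x≈h)

    T-isSubmodule : ∀ v → IsSubmodule (T v)
    T-isSubmodule v = record
      { resp   = λ f≈g Tf → T-scale 1# 1# Tf (λ _ → sym (*-identityˡ _)) (λ i → trans (sym (f≈g i tt)) (sym (*-identityˡ _)))
      ; zero-∈ = ⟨⟩-zeroˡ (λ _ → 0#) v (λ _ → refl) , λ x _ f≈0 → ⊥-elim (fun≢0 x f≈0)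
      ; +-∈    = λ Tf Tg → T-+ Tf Tg (λ _ → refl)
      ; *-∈    = λ a Tf → T-scale 1# a Tf (λ _ → sym (*-identityˡ _)) (λ _ → refl)
      }

  -- The duality of the geometry. It turns flats into pencils, so linearity in `v` is linearity in
  -- `f` for the dual subspace.
  swap : GrPoint K n → GrPoint K n
  swap (flag v f v≉0 f≉0 fv≈0) = flag f v f≉0 v≉0 (trans (⟨⟩-comm v f) fv≈0)

  module Bilinear {s} (S : GrPoint K n → Set s) (stable : ∀ x → ¬ ¬ S x → S x) (S-resp : ∀ x y → x ≃ y → S x → S y)
           (closed : ∀ L x y z → ¬ x ≃ y → x ∈ L → y ∈ L → S x → S y → z ∈ L → S z) where
    module P = Pencils S stable S-resp (λ v g h a b c d → closed (pencil v g h a b c d))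
    module P° = Pencils (S ∘ swap) (λ x → stable (swap x)) (λ x y (v∥ , f∥) → S-resp (swap x) (swap y) (f∥ , v∥))
      (λ v g h v≉0 ind gv≈0 hv≈0 x y z x≄y → closed (flat v g h v≉0 ind (trans (⟨⟩-comm v g) gv≈0) (trans (⟨⟩-comm v h) hv≈0))
        (swap x) (swap y) (swap z) (λ (v∥ , f∥) → x≄y (f∥ , v∥)))
    open P public using (T; T-scale)

    T⇒T° : ∀ {v f} → T v f → P°.T f v
    T⇒T° {v} {f} (fv≈0 , mem) = trans (⟨⟩-comm v f) fv≈0 , λ x v≈ f≈ → mem (swap x) f≈ v≈

    T°⇒T : ∀ {v f} → P°.T f v → T v f
    T°⇒T {v} {f} (vf≈0 , mem) = trans (⟨⟩-comm f v) vf≈0 , λ x v≈ f≈ →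
      -- The double dual has the coordinates of `x` but a different incidence proof, so it is only
      -- equivalent to `x`.
      S-resp (swap (swap x)) x (≈⇒∥ (λ _ → refl) , ≈⇒∥ (λ _ → refl)) (mem (swap x) f≈ v≈)

    Tᵛ : ∀ v → IsSubmodule (T v)
    Tᵛ = P.T-isSubmodule

    Tᶠ : ∀ f → IsSubmodule (λ v → T v f)
    Tᶠ f = record
      { resp   = λ u≈v Tu → T°⇒T (resp u≈v (T⇒T° Tu))
      ; zero-∈ = T°⇒T zero-∈
      ; +-∈    = λ Tu Tv → T°⇒T (+-∈ (T⇒T° Tu) (T⇒T° Tv))
      ; *-∈    = λ a Tu → T°⇒T (*-∈ a (T⇒T° Tu))
      }
      where open IsSubmodule (P°.T-isSubmodule f)

-- Standard basis vectors.

module BasisVectors {k ℓ} (K : CommutativeRing k ℓ) where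
  open CommutativeRingExtras K

  δ : ∀ {n} → Fin n → Fin n → Carrier
  δ zero    zero    = 1#
  δ zero    (suc _) = 0#
  δ (suc _) zero    = 0#
  δ (suc i) (suc j) = δ i j

  δ-diagonal : ∀ {n} (i : Fin n) → δ i i ≈ 1#
  δ-diagonal zero    = refl
  δ-diagonal (suc i) = δ-diagonal i

  δ-off-diagonal : ∀ {n} {i j : Fin n} → i ≢ j → δ i j ≈ 0#
  δ-off-diagonal {i = zero}  {zero}  i≢j = ⊥-elim (i≢j ≡.refl)
  δ-off-diagonal {i = zero}  {suc j} i≢j = refl
  δ-off-diagonal {i = suc i} {zero}  i≢j = refl
  δ-off-diagonal {i = suc i} {suc j} i≢j = δ-off-diagonal (i≢j ∘ ≡.cong suc)

  basis-expansion : ∀ {n} (w : Fin n → Carrier) m → sum (λ l → w l * δ l m) ≈ w m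
  basis-expansion {suc n} w zero    = trans (+-cong (*-identityʳ _) (sum-zero {n} λ l → zeroʳ (w (suc l)))) (+-identityʳ _)
  basis-expansion {suc n} w (suc m) = trans (+-cong (zeroʳ _) (basis-expansion (w ∘ suc) m)) (+-identityˡ _)

-- The auxiliary coordinate on which scalars are added and multiplied.
third : ∀ {n} (i j : Fin (suc (suc (suc n)))) → ∃[ k ] k ≢ i × k ≢ j
third zero          zero          = suc zero , (λ ()) , λ ()
third zero          (suc zero)    = suc (suc zero) , (λ ()) , λ ()
third zero          (suc (suc _)) = suc zero , (λ ()) , λ ()
third (suc zero)    zero          = suc (suc zero) , (λ ()) , λ ()
third (suc zero)    (suc _)       = zero , (λ ()) , λ ()
third (suc (suc _)) zero          = suc zero , (λ ()) , λ ()
third (suc (suc _)) (suc _)       = zero , (λ ()) , λ ()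

-- From the standard flags to all flags rational over F_p(c).

module RationalFlags {k ℓ} (K : CommutativeRing k ℓ) {p : ℕ} (pr : Prime p) (closure : IsAlgebraicClosureOfFp K p) (n : ℕ) where
  open IsAlgebraicClosureOfFp closure
  open CommutativeRingExtras K
  open AlgebraicClosure K pr closure
  open Pairing K (suc (suc n))
  open Proportionality K isField (suc (suc n))
  open BasisVectors K
  open FunctionSubmodule K isField (Fin (suc (suc (suc n)))) (λ _ → ⊤) using (sum-∈)

  Index : Set
  Index = Fin (suc (suc (suc n)))

  module _ {t} (T : V → V → Set t) (Tᵛ : ∀ v → IsSubmodule (T v)) (Tᶠ : ∀ f → IsSubmodule (λ v → T v f)) where

    private
      linᵛ : ∀ {u v w f} a b → T u f → T v f → (∀ l → w l ≈ a * u l + b * v l) → T w f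
      linᵛ {f = f} a b Tu Tv w≈ = IsSubmodule.combination (Tᶠ f) Tu Tv (a , b , λ l _ → w≈ l)

      linᶠ : ∀ {v f g h} a b → T v f → T v g → (∀ l → h l ≈ a * f l + b * g l) → T v h
      linᶠ {v = v} a b Tf Tg h≈ = IsSubmodule.combination (Tᵛ v) Tf Tg (a , b , λ l _ → h≈ l)

    -- A point with coordinate `a` on the line through basis points i and j, with the functional on
    -- these two coordinates that kills it. As a record, it lets `a`, `i` and `j` be inferred.
    record OnLine (a : Carrier) (i j : Index) : Set t where
      constructor on-line
      field flag-∈ : T (λ l → δ i l + a * δ j l) (λ l → a * δ i l - δ j l)

    module _ (E : ∀ i j → i ≢ j → T (δ i) (δ j)) where

      private
        Eᶠ : ∀ a {i j k} → k ≢ i → k ≢ j → T (δ k) (λ l → a * δ i l - δ j l)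
        Eᶠ a {i} {j} {k} k≢i k≢j = linᶠ a (- 1#) (E k i k≢i) (E k j k≢j) λ l →
          solve 3 (λ a x y → a :* x :- y := a :* x :+ (:- :1) :* y) refl a (δ i l) (δ j l)

        Eᵛ : ∀ a {i j k} → i ≢ k → j ≢ k → T (λ l → δ i l + a * δ j l) (δ k)
        Eᵛ a {i} {j} {k} i≢k j≢k = linᵛ 1# a (E i k i≢k) (E j k j≢k) λ l →
          solve 3 (λ a x y → x :+ a :* y := :1 :* x :+ a :* y) refl a (δ i l) (δ j l)

      OnLine-resp : ∀ {a b i j} → a ≈ b → OnLine a i j → OnLine b i j
      OnLine-resp {a} {b} {i} {j} a≈b (on-line Ta) = on-line (linᵛ {f = λ l → b * δ i l - δ j l} 1# 0#
        -- A combination with coefficients 1# and 0# serves as mere rewriting of the flag.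
        (linᶠ 1# 0# Ta Ta λ l → trans (+-congʳ (*-congʳ (sym a≈b))) (solve 1 (λ x → x := :1 :* x :+ :0 :* x) refl _))
        (linᶠ 1# 0# Ta Ta λ l → trans (+-congʳ (*-congʳ (sym a≈b))) (solve 1 (λ x → x := :1 :* x :+ :0 :* x) refl _))
        (λ l → trans (+-congˡ (*-congʳ (sym a≈b))) (solve 1 (λ x → x := :1 :* x :+ :0 :* x) refl _)))

      -- The same flag read with i and j exchanged: δⱼ + bδᵢ is b times δᵢ + aδⱼ, and bδⱼ - δᵢ is -b
      -- times aδᵢ - δⱼ.
      OnLine-inv : ∀ {a b i j} → a * b ≈ 1# → OnLine a i j → OnLine b j i
      OnLine-inv {a} {b} {i} {j} ab≈1 (on-line Ta) = on-line (linᵛ {f = λ l → b * δ j l - δ i l} b 0# Tf Tf λ l →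
          trans (solve 2 (λ x y → y :+ x := x :+ :1 :* y) refl (b * δ i l) (δ j l))
            (trans (+-congˡ (*-congʳ (sym ab≈1)))
              (solve 4 (λ a b x y → b :* x :+ (a :* b) :* y := b :* (x :+ a :* y) :+ :0 :* (x :+ a :* y)) refl a b (δ i l) (δ j l))))
        where
        Tf : T (λ l → δ i l + a * δ j l) (λ l → b * δ j l - δ i l)
        Tf = linᶠ (- b) 0# Ta Ta λ l →
          trans (solve 2 (λ x y → y :- x := y :- :1 :* x) refl (δ i l) (b * δ j l))
            (trans (+-congˡ (-‿cong (*-congʳ (sym ab≈1))))
              (solve 4 (λ a b x y → b :* y :- (a :* b) :* x := (:- b) :* (a :* x :- y) :+ :0 :* (a :* x :- y)) refl a b (δ i l) (δ j l)))

      OnLine-* : ∀ {a b i j k} → i ≢ j → j ≢ k → i ≢ k → OnLine a i j → OnLine b j k → OnLine (a * b) i k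
      OnLine-* {a} {b} {i} {j} {k} i≢j j≢k i≢k (on-line Ta) (on-line Tb) = on-line (
        linᵛ 1# (- a) Tvf (Eᶠ (a * b) (i≢j ∘ ≡.sym) j≢k) λ l →
          solve 5 (λ a b x y z → x :+ (a :* b) :* z := :1 :* (x :+ a :* y :+ (a :* b) :* z) :+ (:- a) :* y) refl a b (δ i l) (δ j l) (δ k l))
        where
        v : V
        v l = δ i l + a * δ j l + (a * b) * δ k l
        Tv₁ : T v (λ l → a * δ i l - δ j l)
        Tv₁ = linᵛ 1# (a * b) Ta (Eᶠ a (i≢k ∘ ≡.sym) (j≢k ∘ ≡.sym)) λ l →
          solve 5 (λ a b x y z → x :+ a :* y :+ (a :* b) :* z := :1 :* (x :+ a :* y) :+ (a :* b) :* z) refl a b (δ i l) (δ j l) (δ k l)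
        Tv₂ : T v (λ l → b * δ j l - δ k l)
        Tv₂ = linᵛ 1# a (Eᶠ b i≢j i≢k) Tb λ l →
          solve 5 (λ a b x y z → x :+ a :* y :+ (a :* b) :* z := :1 :* x :+ a :* (y :+ b :* z)) refl a b (δ i l) (δ j l) (δ k l)
        Tvf : T v (λ l → (a * b) * δ i l - δ k l)
        Tvf = linᶠ b 1# Tv₁ Tv₂ λ l →
          solve 5 (λ a b x y z → (a :* b) :* x :- z := b :* (a :* x :- y) :+ :1 :* (b :* y :- z)) refl a b (δ i l) (δ j l) (δ k l)

      OnLine-minus-one : ∀ {i j k} → i ≢ j → j ≢ k → i ≢ k → OnLine 1# i j → OnLine 1# j k → OnLine (- 1#) i k
      OnLine-minus-one {i} {j} {k} i≢j j≢k i≢k (on-line Tij) (on-line Tjk) = on-line (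
        linᶠ (- 1#) (- 1#) Tvf (Eᵛ (- 1#) i≢j (j≢k ∘ ≡.sym)) λ l →
          solve 3 (λ x y z → (:- :1) :* x :- z := (:- :1) :* (x :- y :+ z) :+ (:- :1) :* y) refl (δ i l) (δ j l) (δ k l))
        where
        f : V
        f l = δ i l - δ j l + δ k l
        Tf₁ : T (λ l → δ i l + 1# * δ j l) f
        Tf₁ = linᶠ 1# 1# Tij (Eᵛ 1# i≢k j≢k) λ l →
          solve 3 (λ x y z → x :- y :+ z := :1 :* (:1 :* x :- y) :+ :1 :* z) refl (δ i l) (δ j l) (δ k l)
        Tf₂ : T (λ l → δ j l + 1# * δ k l) f
        Tf₂ = linᶠ (- 1#) 1# Tjk (Eᵛ 1# (i≢j ∘ ≡.sym) (i≢k ∘ ≡.sym)) λ l →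
          solve 3 (λ x y z → x :- y :+ z := (:- :1) :* (:1 :* y :- z) :+ :1 :* x) refl (δ i l) (δ j l) (δ k l)
        Tvf : T (λ l → δ i l + (- 1#) * δ k l) f
        Tvf = linᵛ 1# (- 1#) Tf₁ Tf₂ λ l →
          solve 3 (λ x y z → x :+ (:- :1) :* z := :1 :* (x :+ :1 :* y) :+ (:- :1) :* (y :+ :1 :* z)) refl (δ i l) (δ j l) (δ k l)

      -- The functional (a+b)δᵢ - δⱼ - δₖ is related to δᵢ + aδⱼ + bδₖ and, by the scalar -1 on the
      -- line jk, to δⱼ - δₖ. Adding b times the latter moves b from k to j, after which δₖ is
      -- dropped from the functional.
      OnLine-+ : ∀ {a b i j k} → i ≢ j → j ≢ k → i ≢ k → OnLine (- 1#) j k → OnLine a i j → OnLine b i k → OnLine (a + b) i j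
      OnLine-+ {a} {b} {i} {j} {k} i≢j j≢k i≢k (on-line T-1) (on-line Ta) (on-line Tb) = on-line (
        linᶠ 1# 1# Twf (Eᵛ (a + b) i≢k j≢k) λ l →
          solve 5 (λ a b x y z → (a :+ b) :* x :- y := :1 :* ((a :+ b) :* x :- y :- z) :+ :1 :* z) refl a b (δ i l) (δ j l) (δ k l))
        where
        v f : V
        v l = δ i l + a * δ j l + b * δ k l
        f l = (a + b) * δ i l - δ j l - δ k l
        Tv₁ : T v (λ l → a * δ i l - δ j l)
        Tv₁ = linᵛ 1# b Ta (Eᶠ a (i≢k ∘ ≡.sym) (j≢k ∘ ≡.sym)) λ l →
          solve 5 (λ a b x y z → x :+ a :* y :+ b :* z := :1 :* (x :+ a :* y) :+ b :* z) refl a b (δ i l) (δ j l) (δ k l)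
        Tv₂ : T v (λ l → b * δ i l - δ k l)
        Tv₂ = linᵛ 1# a Tb (Eᶠ b (i≢j ∘ ≡.sym) j≢k) λ l →
          solve 5 (λ a b x y z → x :+ a :* y :+ b :* z := :1 :* (x :+ b :* z) :+ a :* y) refl a b (δ i l) (δ j l) (δ k l)
        Tvf : T v f
        Tvf = linᶠ 1# 1# Tv₁ Tv₂ λ l →
          solve 5 (λ a b x y z → (a :+ b) :* x :- y :- z := :1 :* (a :* x :- y) :+ :1 :* (b :* x :- z)) refl a b (δ i l) (δ j l) (δ k l)
        Tuf : T (λ l → δ j l + (- 1#) * δ k l) f
        Tuf = linᶠ 1# (a + b) T-1 (Eᵛ (- 1#) (i≢j ∘ ≡.sym) (i≢k ∘ ≡.sym)) λ l →
          solve 5 (λ a b x y z → (a :+ b) :* x :- y :- z := :1 :* ((:- :1) :* y :- z) :+ (a :+ b) :* x) refl a b (δ i l) (δ j l) (δ k l)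
        Twf : T (λ l → δ i l + (a + b) * δ j l) f
        Twf = linᵛ 1# b Tvf Tuf λ l →
          solve 5 (λ a b x y z → x :+ (a :+ b) :* y := :1 :* (x :+ a :* y :+ b :* z) :+ b :* (y :+ (:- :1) :* z)) refl a b (δ i l) (δ j l) (δ k l)

      Rational : Carrier → Set _
      Rational a = ∀ i j → i ≢ j → OnLine a i j

      module _ {c} (units : ∀ i → zero ≢ i → OnLine 1# zero i) (scalar : OnLine c zero (suc zero)) where

        Rational-1 : Rational 1#
        Rational-1 zero    j       i≢j = units j i≢j
        Rational-1 (suc i) zero    i≢j = OnLine-inv (*-identityˡ 1#) (units (suc i) λ ())
        Rational-1 (suc i) (suc j) i≢j = OnLine-resp (*-identityˡ 1#)
          (OnLine-* (λ ()) (λ ()) i≢j (OnLine-inv (*-identityˡ 1#) (units (suc i) λ ())) (units (suc j) λ ()))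

        -- A product with 1# on another line changes one index and keeps the scalar; the two lemmas
        -- after this one use the same device.
        Rational-c-zero : ∀ j → zero ≢ j → OnLine c zero j
        Rational-c-zero zero          0≢0 = ⊥-elim (0≢0 ≡.refl)
        Rational-c-zero (suc zero)    _   = scalar
        Rational-c-zero (suc (suc j)) _   = OnLine-resp (*-identityʳ c)
          (OnLine-* (λ ()) (λ ()) (λ ()) scalar (Rational-1 (suc zero) (suc (suc j)) λ ()))

        Rational-c-suc : ∀ i j → i ≢ suc j → OnLine c i (suc j)
        Rational-c-suc zero    j i≢j = Rational-c-zero (suc j) i≢j
        Rational-c-suc (suc i) j i≢j = OnLine-resp (*-identityˡ c)
          (OnLine-* (λ ()) (λ ()) i≢j (Rational-1 (suc i) zero λ ()) (Rational-c-zero (suc j) λ ()))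

        Rational-c : Rational c
        Rational-c i (suc j) i≢j = Rational-c-suc i j i≢j
        -- The index 0 as a target cannot be reached through 0, so the detour uses another index.
        Rational-c i zero    i≢0 with third i zero
        ... | zero  , _   , 0≢0 = ⊥-elim (0≢0 ≡.refl)
        ... | suc m , m≢i , _   = OnLine-resp (*-identityʳ c)
          (OnLine-* (m≢i ∘ ≡.sym) (λ ()) i≢0 (Rational-c-suc i m (m≢i ∘ ≡.sym)) (Rational-1 (suc m) zero λ ()))

        Rational-generated : ∀ {a} → Generated c a → Rational a
        Rational-generated generator = Rational-c
        Rational-generated one       = Rational-1
        Rational-generated minus-one i k i≢k = let (j , j≢i , j≢k) = third i k in
          OnLine-minus-one (j≢i ∘ ≡.sym) j≢k i≢k (Rational-1 i j (j≢i ∘ ≡.sym)) (Rational-1 j k j≢k)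
        Rational-generated (add a∈ b∈) i j i≢j = let (k , k≢i , k≢j) = third i j in
          OnLine-+ i≢j (k≢j ∘ ≡.sym) (k≢i ∘ ≡.sym) (Rational-generated minus-one j k (k≢j ∘ ≡.sym))
            (Rational-generated a∈ i j i≢j) (Rational-generated b∈ i k (k≢i ∘ ≡.sym))
        Rational-generated (mul a∈ b∈) i k i≢k = let (j , j≢i , j≢k) = third i k in
          OnLine-* (j≢i ∘ ≡.sym) j≢k i≢k (Rational-generated a∈ i j (j≢i ∘ ≡.sym)) (Rational-generated b∈ j k j≢k)
        Rational-generated (inv ab≈1 a∈) i j i≢j = OnLine-inv ab≈1 (Rational-generated a∈ j i (i≢j ∘ ≡.sym))
        Rational-generated (resp a≈b a∈) i j i≢j = OnLine-resp a≈b (Rational-generated a∈ i j i≢j)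

        -- If v i = 1, the functionals v j δᵢ - δⱼ span the annihilator of v.
        rational-flag : ∀ i v f → v i ≈ 1# → (∀ j → Generated c (v j)) → ⟨ f , v ⟩ ≈ 0# → T v f
        rational-flag i v f vᵢ≈1 v∈ fv≈0 = IsSubmodule.resp (Tᵛ v) (λ m _ → f≈ m)
          -- The part along δᵢ has coefficient minus the pairing of `f` and `v`, which is zero. The
          -- scalars `- f j` are arbitrary in K, since `T v` is a K-submodule.
          (sum-∈ (Tᵛ v) (suc (suc (suc n))) (λ j l → (- f j) * (v j * δ i l - δ j l)) λ j → IsSubmodule.*-∈ (Tᵛ v) (- f j) (spanning j))
          where
          open ≈-R
          f≈ : ∀ m → sum (λ j → (- f j) * (v j * δ i m - δ j m)) ≈ f m
          f≈ m = begin
            sum (λ j → (- f j) * (v j * δ i m - δ j m))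
              ≈⟨ sum-cong-≋ {suc (suc (suc n))} (λ j → solve 4 (λ f v x y → (:- f) :* (v :* x :- y) := (f :* v) :* (:- x) :+ f :* y) refl (f j) (v j) (δ i m) (δ j m)) ⟩
            sum (λ j → (f j * v j) * - δ i m + f j * δ j m)
              ≈⟨ ∑-distrib-+ (λ j → (f j * v j) * - δ i m) (λ j → f j * δ j m) ⟩
            sum (λ j → (f j * v j) * - δ i m) + sum (λ j → f j * δ j m)
              ≈⟨ +-cong (trans (sym (*-distribʳ-sum (- δ i m) (λ j → f j * v j))) (trans (*-congʳ (trans (sym (⟨⟩≈sum f v)) fv≈0)) (zeroˡ _)))
                        (basis-expansion f m) ⟩
            0# + f m
              ≈⟨ +-identityˡ _ ⟩
            f m ∎
          spanning : ∀ j → T v (λ l → v j * δ i l - δ j l)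
          spanning j with i F.≟ j
          ... | yes ≡.refl = IsSubmodule.resp (Tᵛ v) (λ l _ → sym (trans (+-congʳ (trans (*-congʳ vᵢ≈1) (*-identityˡ _))) (-‿inverseʳ _)))
                               (IsSubmodule.zero-∈ (Tᵛ v))
          -- `v` is the vector of a rational line flag plus `w`, its part off i and j; each basis
          -- vector in `w` is related to `g` by `Eᶠ`.
          ... | no i≢j = linᵛ 1# 1# (OnLine.flag-∈ (Rational-generated (v∈ j) i j i≢j))
              (sum-∈ (Tᶠ g) (suc (suc (suc n))) (λ l m → w l * δ l m) others)
              λ m → trans (v≈ m) (+-cong (sym (*-identityˡ _)) (trans (sym (basis-expansion w m)) (sym (*-identityˡ _))))
            where
            g w : V
            g m = v j * δ i m - δ j m
            w l with l F.≟ i | l F.≟ j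
            ... | no _  | no _  = v l
            ... | yes _ | _     = 0#
            ... | no _  | yes _ = 0#
            others : ∀ l → T (λ m → w l * δ l m) g
            others l with l F.≟ i | l F.≟ j
            ... | no l≢i | no l≢j = IsSubmodule.*-∈ (Tᶠ g) (v l) (Eᶠ (v j) l≢i l≢j)
            ... | yes _  | _      = IsSubmodule.resp (Tᶠ g) (λ m _ → sym (zeroˡ (δ l m))) (IsSubmodule.zero-∈ (Tᶠ g))
            ... | no _   | yes _  = IsSubmodule.resp (Tᶠ g) (λ m _ → sym (zeroˡ (δ l m))) (IsSubmodule.zero-∈ (Tᶠ g))
            v≈ : ∀ m → v m ≈ (δ i m + v j * δ j m) + w m
            v≈ m with m F.≟ i | m F.≟ j
            ... | no m≢i | no m≢j = sym (trans (+-congʳ (trans (+-cong (δ-off-diagonal (m≢i ∘ ≡.sym)) (trans (*-congˡ (δ-off-diagonal (m≢j ∘ ≡.sym))) (zeroʳ _)))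
                                      (+-identityˡ 0#))) (+-identityˡ _))
            ... | yes ≡.refl | _  = trans vᵢ≈1 (sym (trans (+-identityʳ _) (trans (+-cong (δ-diagonal i) (trans (*-congˡ (δ-off-diagonal (i≢j ∘ ≡.sym))) (zeroʳ _)))
                                      (+-identityʳ 1#))))
            ... | no m≢i | yes ≡.refl = sym (trans (+-identityʳ _) (trans (+-cong (δ-off-diagonal i≢j) (trans (*-congˡ (δ-diagonal j)) (*-identityʳ _))) (+-identityˡ _)))

-- Standard flags indexed by matrix entries.

entry : ∀ m → Fin (m ^ 2) → Fin m × Fin m
-- `m ^ 2` unfolds to `m * (m * 1)`, whence the cast of the column index.
entry m l = map₂ (F.cast (ℕ.*-identityʳ m)) (remQuot {m} (m ℕ.* 1) l)

position : ∀ m → Fin m → Fin m → Fin (m ^ 2)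
position m i j = combine i (F.cast (≡.sym (ℕ.*-identityʳ m)) j)

entry-position : ∀ m i j → entry m (position m i j) ≡ (i , j)
entry-position m i j = ≡.trans
  (≡.cong (map₂ (F.cast (ℕ.*-identityʳ m))) (F.remQuot-combine {m} {m ℕ.* 1} i (F.cast (≡.sym (ℕ.*-identityʳ m)) j)))
  (≡.cong (i ,_) (F.cast-involutive (ℕ.*-identityʳ m) (≡.sym (ℕ.*-identityʳ m)) j))

position-entry : ∀ m l → position m (proj₁ (entry m l)) (proj₂ (entry m l)) ≡ l
position-entry m l = ≡.trans
  (≡.cong (combine (proj₁ (entry m l))) (F.cast-involutive (≡.sym (ℕ.*-identityʳ m)) (ℕ.*-identityʳ m) _))
  (F.combine-remQuot {m} (m ℕ.* 1) l)

module StandardFlags {k ℓ} (K : CommutativeRing k ℓ) (isField : IsField K) (n : ℕ) where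
  open CommutativeRingExtras K
  open IsDivisionRing isField
  open Pairing K (suc n)
  open BasisVectors K
  open GrPoint

  size : ℕ
  size = suc (suc n)

  Index : Set
  Index = Fin size

  1≉0 : ¬ 1# ≈ 0#
  1≉0 = nontrivial

  ⟨_,δ⟩ : ∀ f i → ⟨ f , δ i ⟩ ≈ f i
  ⟨ f ,δ⟩ i = trans (⟨⟩≈sum f (δ i)) (expand f i)
    where
    expand : ∀ {m} (f : Fin m → Carrier) i → sum (λ l → f l * δ i l) ≈ f i
    expand {suc m} f zero    = trans (+-cong (*-identityʳ _) (sum-zero {m} λ l → zeroʳ (f (suc l)))) (+-identityʳ _)
    expand {suc m} f (suc i) = trans (+-cong (zeroʳ _) (expand (f ∘ suc) i)) (+-identityˡ _)

  δ-flag : ∀ i j → i ≢ j → GrPoint K (suc n)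
  δ-flag i j i≢j = flag (δ i) (δ j)
    (λ δ≈0 → 1≉0 (trans (sym (δ-diagonal i)) (δ≈0 i))) (λ δ≈0 → 1≉0 (trans (sym (δ-diagonal j)) (δ≈0 j)))
    (trans (⟨ δ j ,δ⟩ i) (δ-off-diagonal (i≢j ∘ ≡.sym)))

  lineᵛ lineᶠ : Carrier → Index → Index → V
  lineᵛ a i j l = δ i l + a * δ j l
  lineᶠ a i j l = a * δ i l - δ j l

  -- Abstract, because unfolding these proofs makes the comparison of flags below very slow.
  abstract
    lineᵛ≉0 : ∀ a i j → i ≢ j → NonZeroV K (suc n) (lineᵛ a i j)
    lineᵛ≉0 a i j i≢j v≈0 = 1≉0 (trans (sym (trans (+-cong (δ-diagonal i) (*-congˡ (δ-off-diagonal (i≢j ∘ ≡.sym))))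
      (solve 1 (λ a → :1 :+ a :* :0 := :1) refl a))) (v≈0 i))

    lineᶠⱼ≈-1 : ∀ a i j → i ≢ j → lineᶠ a i j j ≈ - 1#
    lineᶠⱼ≈-1 a i j i≢j = trans (+-cong (*-congˡ (δ-off-diagonal i≢j)) (-‿cong (δ-diagonal j))) (solve 1 (λ a → a :* :0 :- :1 := :- :1) refl a)

    lineᶠ≉0 : ∀ a i j → i ≢ j → NonZeroV K (suc n) (lineᶠ a i j)
    lineᶠ≉0 a i j i≢j f≈0 = 1≉0 (trans (solve 0 (:1 := :- (:- :1)) refl)
      (trans (-‿cong (trans (sym (lineᶠⱼ≈-1 a i j i≢j)) (f≈0 j))) -0#≈0#))

    line-incident : ∀ a i j → i ≢ j → ⟨ lineᶠ a i j , lineᵛ a i j ⟩ ≈ 0#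
    line-incident a i j i≢j = trans (⟨⟩-+ʳ f (δ i) (λ l → a * δ j l))
      (trans (+-cong (⟨ f ,δ⟩ i) (trans (⟨⟩-*ʳ f a (δ j)) (*-congˡ (⟨ f ,δ⟩ j))))
        (trans (+-cong fᵢ≈a (*-congˡ (lineᶠⱼ≈-1 a i j i≢j))) (solve 1 (λ a → a :+ a :* (:- :1) := :0) refl a)))
      where
      f : V
      f = lineᶠ a i j
      fᵢ≈a : f i ≈ a
      fᵢ≈a = trans (+-cong (*-congˡ (δ-diagonal i)) (-‿cong (δ-off-diagonal (i≢j ∘ ≡.sym)))) (solve 1 (λ a → a :* :1 :- :0 := a) refl a)

  line-flag : Carrier → ∀ i j → i ≢ j → GrPoint K (suc n)
  line-flag a i j i≢j = flag (lineᵛ a i j) (lineᶠ a i j) (lineᵛ≉0 a i j i≢j) (lineᶠ≉0 a i j i≢j) (line-incident a i j i≢j)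

  0≢suc : ∀ {i : Fin (suc n)} → zero ≢ Fin.suc i
  0≢suc ()

  base′ : Carrier → ∀ i j → Dec (i ≡ j) → GrPoint K (suc n)
  base′ c i       j       (no i≢j) = δ-flag i j i≢j
  base′ c zero    zero    (yes _)  = line-flag c zero (suc zero) 0≢suc
  base′ c zero    (suc j) (yes ())
  base′ c (suc i) j       (yes _)  = line-flag 1# zero (suc i) 0≢suc

  base : Carrier → Index → Index → GrPoint K (suc n)
  base c i j = base′ c i j (i F.≟ j)

  base-off-diagonal : ∀ c {i j} → i ≢ j → vec (base c i j) ≡ δ i × fun (base c i j) ≡ δ j
  base-off-diagonal c {i} {j} i≢j = off (i F.≟ j)
    where
    off : ∀ d → vec (base′ c i j d) ≡ δ i × fun (base′ c i j d) ≡ δ j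
    off (no _)    = ≡.refl , ≡.refl
    off (yes i≡j) = ⊥-elim (i≢j i≡j)

  base-diagonal : ∀ c i → base c (suc i) (suc i) ≡ line-flag 1# zero (suc i) 0≢suc
  base-diagonal c i = diagonal (suc i F.≟ suc i)
    where
    diagonal : ∀ d → base′ c (suc i) (suc i) d ≡ line-flag 1# zero (suc i) 0≢suc
    diagonal (yes _)  = ≡.refl
    diagonal (no i≢i) = ⊥-elim (i≢i ≡.refl)

-- Upper bound for the embedding rank.

module EmbeddingRankUpper {k ℓ} (K : CommutativeRing k ℓ) {p : ℕ} (pr : Prime p) (closure : IsAlgebraicClosureOfFp K p) (n : ℕ)
                          {r ℓr m ℓm} (D : Ring r ℓr) (W : LeftModule D m ℓm)
                          (embedding : ProjectiveEmbedding (Gr1n K (suc (suc n))) D W) where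
  open IsAlgebraicClosureOfFp closure
  open CommutativeRingExtras K
  open AlgebraicClosure K pr closure using (Generated; Generated-trans; common-generator)
  open Pairing K (suc (suc n))
  open Proportionality K isField (suc (suc n)) hiding (IsSubmodule; line-closed)
  open BasisVectors K
  open StandardFlags K isField (suc n)
  open ProjectiveEmbedding embedding
  open DivisionRingModule isDivisionRing W
  open LeftModule W using (Carrierᴹ; ≈ᴹ-sym; _*ₗ_)
  open GrPoint

  private
    Point = GrPoint K (suc (suc n))
    _≃_ = _≃G_ K (suc (suc n))
    _∈_ = _∈G_ K (suc (suc n))

  -- The vector of the flag has a representative over F_p(c) with an entry 1, as `rational-flag`
  -- expects.
  NormalisedIn : Carrier → Point → Set _
  NormalisedIn c x = Σ Index λ i → Σ Carrier λ y → vec x i * y ≈ 1# × (∀ j → Generated c (vec x j * y))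

  common-field : ∀ xs → ¬ ¬ (∃[ c ] All (NormalisedIn c) xs)
  common-field []       = return (1# , [])
  common-field (x ∷ xs) = do
    b , xs∈       ← common-field xs
    i , xᵢ≉0      ← ¬∀⇒¬¬∃¬ (vec≢0 x)
    let (y , xᵢy≈1 , _) = IsDivisionRing.inverse isField (vec x i) xᵢ≉0
    c , b∈c , x∈c ← common-generator size (λ j → vec x j * y) b
    return (c , (i , y , xᵢy≈1 , x∈c) ∷ All.map (λ { (j , z , xⱼz≈1 , x∈b) → j , z , xⱼz≈1 , λ l → Generated-trans b∈c (x∈b l) }) xs∈)

  module Rational (c : Carrier) where

    frame : Fin (size ^ 2) → Carrierᴹ
    frame l = let (i , j) = entry size l in e (base c i j)

    open IsSubmodule (Span-isSubmodule frame)

    -- The flags whose images lie in the span of the frame; double negation gives the stability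
    -- under which the relation `T` is bilinear.
    S : Point → Set _
    S x = ¬ ¬ Span frame (e x)

    S-resp : ∀ x y → x ≃ y → S x → S y
    S-resp x y x≃y Sx = Sx >>= λ ex∈ → let (a , _ , ey≈) = well-defined x y x≃y in return (resp (≈ᴹ-sym ey≈) (*-∈ a ex∈))

    -- The images of a line lie in a 2-dimensional span, and `injective` makes distinct flags
    -- nonproportional there, as `line-closed` requires.
    S-closed : ∀ L x y z → ¬ x ≃ y → x ∈ L → y ∈ L → S x → S y → z ∈ L → S z
    S-closed L x y z x≄y x∈ y∈ Sx Sy z∈ =
      let (u , v , _ , into , _) = onto-lines L in
      Sx >>= λ ex∈ → Sy >>= λ ey∈ →
      line-closed (Span-isSubmodule frame) (into x x∈) (into y y∈) (nonzero x) (nonzero y) (λ x∥y → x≄y (injective x y x∥y)) ex∈ ey∈ (into z z∈)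

    open SubspaceRelation K pr closure (suc (suc n)) using (module Bilinear)
    open Bilinear S (λ x ¬¬Sx ¬ex∈ → ¬¬Sx λ Sx → Sx ¬ex∈) S-resp S-closed

    S-base : ∀ i j → S (base c i j)
    S-base i j = return (≡.subst (λ (i , j) → Span frame (e (base c i j))) (entry-position size i j) (Span-generator frame (position size i j)))

    S⇒T : ∀ x → S x → T (vec x) (fun x)
    S⇒T x Sx = incident x , λ y v≈ f≈ → S-resp x y (≈⇒∥ v≈ , ≈⇒∥ f≈) Sx

    T-δ : ∀ i j → i ≢ j → T (δ i) (δ j)
    T-δ i j i≢j = let (v≡ , f≡) = base-off-diagonal c i≢j in ≡.subst₂ T v≡ f≡ (S⇒T (base c i j) (S-base i j))

    open RationalFlags K pr closure n using (OnLine; on-line; rational-flag)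

    units : ∀ i → zero ≢ i → OnLine T Tᵛ Tᶠ 1# zero i
    units zero    0≢0 = ⊥-elim (0≢0 ≡.refl)
    units (suc i) _   = on-line (S⇒T (line-flag 1# zero (suc i) 0≢suc) (≡.subst S (base-diagonal c i) (S-base (suc i) (suc i))))

    scalar : OnLine T Tᵛ Tᶠ c zero (suc zero)
    scalar = on-line (S⇒T (base c zero zero) (S-base zero zero))

    S-rational : ∀ x → NormalisedIn c x → S x
    -- The factor `vec x i` undoes the normalisation by `y`.
    S-rational x (i , y , xᵢy≈1 , x∈) = proj₂ (T-scale {g = fun x} (vec x i) 1#
        (rational-flag T Tᵛ Tᶠ T-δ units scalar i (λ j → vec x j * y) (fun x) xᵢy≈1 x∈ fv≈0)
        (λ j → trans (sym (*-identityˡ _)) (trans (*-congʳ (sym xᵢy≈1)) (solve 3 (λ a y b → (a :* y) :* b := a :* (b :* y)) refl _ y _)))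
        (λ j → sym (*-identityˡ _)))
      x (λ _ → refl) (λ _ → refl)
      where
      fv≈0 : ⟨ fun x , (λ j → vec x j * y) ⟩ ≈ 0#
      fv≈0 = trans (⟨⟩-congʳ (fun x) _ (λ j → y * vec x j) λ j → *-comm (vec x j) y)
        (trans (⟨⟩-*ʳ (fun x) y (vec x)) (trans (*-congˡ (incident x)) (zeroʳ y)))

    spanned : ∀ cs → All (NormalisedIn c) (List.map proj₂ cs) →
              ¬ ¬ Span frame (sumListᴹ W (List.map (λ { (s , x) → s *ₗ e x }) cs))
    spanned []             _         = return zero-∈
    spanned ((s , x) ∷ cs) (x∈ ∷ cs∈) = do
      ex∈   ← S-rational x x∈
      rest∈ ← spanned cs cs∈
      return (+-∈ (*-∈ s ex∈) rest∈)

  -- The frame depends on `c`, and so on the given vectors; only its size is the same for all of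
  -- them.
  dimension-≤ : DimAtMost W (size ^ 2)
  dimension-≤ l vs independent = decidable-stable (l ℕ.≤? size ^ 2) (do
    let terms = λ i → List.map proj₂ (proj₁ (spanning (vs i)))
    c , all∈ ← common-field (List.concat (List.tabulate terms))
    let open Rational c
    return (independent-≤-spanning frame vs independent λ i →
      spanned (proj₁ (spanning (vs i))) (All.tabulate⁻ (All.concat⁻ {xss = List.tabulate terms} all∈) i) >>= λ w∈ →
      return (IsSubmodule.resp (Span-isSubmodule frame) (≈ᴹ-sym (proj₂ (spanning (vs i)))) w∈)))

-- Lower bound: the embedding into trace zero matrices.

module EmbeddingRankLower {k ℓ} (K : CommutativeRing k ℓ) {p : ℕ} (pr : Prime p) (closure : IsAlgebraicClosureOfFp K p) (n : ℕ) where
  open IsAlgebraicClosureOfFp closure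
  open CommutativeRingExtras K
  open AlgebraicOverFp K isField pr characteristic algebraic using (unimodular; annihilator-zero; dot)
  open Pairing K (suc n)
  open Proportionality K isField (suc n) using (*-nonzero; _∥_; ≈⇒∥)
  open BasisVectors K
  open StandardFlags K isField n
  open GrPoint
  open ≈-R

  corner : Index × Index
  corner = zero , zero

  -- The flag (v , f) goes to the trace zero matrix v ⊗ f; since the trace determines
  -- the corner entry from the others, that entry is ignored.
  W : LeftModule ring k ℓ
  W = functions K (Index × Index) (_≢ corner)

  open LeftModule W using (Carrierᴹ; _≈ᴹ_; _+ᴹ_; _*ₗ_; 0ᴹ; ≈ᴹ-refl; ≈ᴹ-sym; ≈ᴹ-trans; +ᴹ-cong; +ᴹ-assoc; +ᴹ-identityˡ; *ₗ-cong; *ₗ-distribˡ; *ₗ-assoc; *ₗ-zeroʳ)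

  trace : Carrierᴹ → Carrier
  trace A = sum λ i → A (i , i)

  -- Recovers the ignored corner by cancelling the other diagonal entries from the trace.
  trace-zero-ext : ∀ {A B} → trace A ≈ 0# → trace B ≈ 0# → A ≈ᴹ B → ∀ i j → A (i , j) ≈ B (i , j)
  trace-zero-ext {A} {B} tA tB A≈B zero    (suc j) = A≈B (zero , suc j) (λ ())
  trace-zero-ext {A} {B} tA tB A≈B (suc i) j       = A≈B (suc i , j) (λ ())
  trace-zero-ext {A} {B} tA tB A≈B zero    zero    = +-cancelʳ (sum λ i → A (suc i , suc i)) (A corner) (B corner)
    (trans tA (trans (sym tB) (+-congˡ {B corner} (sum-cong-≋ {suc n} λ i → sym (A≈B (suc i , suc i) (λ ()))))))

  _⊗_ : V → V → Carrierᴹ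
  (v ⊗ f) (i , j) = v i * f j

  trace-⊗ : ∀ v f → ⟨ f , v ⟩ ≈ 0# → trace (v ⊗ f) ≈ 0#
  trace-⊗ v f fv≈0 = trans (sym (⟨⟩≈sum v f)) (trans (⟨⟩-comm v f) fv≈0)

  trace-0 : trace 0ᴹ ≈ 0#
  trace-0 = sum-zero {suc (suc n)} λ _ → refl

  trace-* : ∀ c A → trace A ≈ 0# → trace (c *ₗ A) ≈ 0#
  trace-* c A tA = trans (sym (*-distribˡ-sum c (λ i → A (i , i)))) (trans (*-congˡ tA) (zeroʳ c))

  trace-+ : ∀ A B → trace A ≈ 0# → trace B ≈ 0# → trace (A +ᴹ B) ≈ 0#
  trace-+ A B tA tB = trans (∑-distrib-+ (λ i → A (i , i)) (λ i → B (i , i))) (trans (+-cong tA tB) (+-identityˡ 0#))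

  trace-comb : ∀ s t A B → trace A ≈ 0# → trace B ≈ 0# → trace (s *ₗ A +ᴹ t *ₗ B) ≈ 0#
  trace-comb s t A B tA tB = trace-+ (s *ₗ A) (t *ₗ B) (trace-* s A tA) (trace-* t B tB)

  ⊗-zero : ∀ (v f : V) → ¬ (∀ i → v i ≈ 0#) → (∀ i j → v i * f j ≈ 0#) → ∀ j → f j ≈ 0#
  ⊗-zero v f v≉0 vf≈0 j = annihilator-zero {v = v} v≉0 λ i → trans (*-comm _ _) (vf≈0 i j)

  -- A linear form `b` with value 1# on `g` contracts the equation to w = c(b·f) v. An explicit
  -- factor is demanded, so `unimodular` replaces the choice of a nonzero entry.
  ⊗-injective : ∀ {v f w g : V} {c} → ¬ (∀ i → w i ≈ 0#) → ¬ (∀ j → g j ≈ 0#) → (∀ i j → w i * g j ≈ c * (v i * f j)) → v ∥ w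
  ⊗-injective {v} {f} {w} {g} {c} w≉0 g≉0 eq =
    μ , (λ μ≈0 → w≉0 λ i → trans (w≈ i) (trans (*-congʳ μ≈0) (zeroˡ _))) , w≈
    where
    b = proj₁ (unimodular g≉0)
    μ = c * dot b f
    w≈ : ∀ i → w i ≈ μ * v i
    w≈ i = begin
      w i                                   ≈⟨ *-identityʳ _ ⟨
      w i * 1#                              ≈⟨ *-congˡ (proj₂ (unimodular g≉0)) ⟨
      w i * dot b g                         ≈⟨ *-distribˡ-sum (w i) (λ j → b j * g j) ⟩
      sum (λ j → w i * (b j * g j))         ≈⟨ sum-cong-≋ {size} (λ j → trans (solve 3 (λ w b g → w :* (b :* g) := b :* (w :* g)) refl (w i) (b j) (g j))
                                                 (trans (*-congˡ (eq i j)) (solve 4 (λ b c v f → b :* (c :* (v :* f)) := (c :* v) :* (b :* f)) refl (b j) c (v i) (f j)))) ⟩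
      sum (λ j → (c * v i) * (b j * f j))   ≈⟨ *-distribˡ-sum (c * v i) (λ j → b j * f j) ⟨
      (c * v i) * dot b f                   ≈⟨ solve 3 (λ c v d → (c :* v) :* d := (c :* d) :* v) refl c (v i) (dot b f) ⟩
      μ * v i                               ∎

  e : GrPoint K (suc n) → Carrierᴹ
  e x = vec x ⊗ fun x

  trace-e : ∀ x → trace (e x) ≈ 0#
  trace-e x = trace-⊗ (vec x) (fun x) (incident x)

  -- A pencil goes to `v` tensor the span of g and h, a flat to the span of a and b tensor `f`;
  -- every vector there is again a pure tensor. For independence the corner entry is first restored
  -- by `trace-zero-ext`.
  onto-lines : ∀ (L : GrLine K (suc n)) → Σ Carrierᴹ λ u → Σ Carrierᴹ λ v →
               Independent2 W u v ×
               (∀ x → _∈G_ K (suc n) x L → InSpan2 W u v (e x)) ×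
               (∀ w → ¬ (w ≈ᴹ 0ᴹ) → InSpan2 W u v w → ∃ λ x → _∈G_ K (suc n) x L × Proportionalᴹ W (e x) w)
  onto-lines (pencil v g h v≉0 ind gv≈0 hv≈0) = v ⊗ g , v ⊗ h ,
    (λ s t eq → ind s t (⊗-zero v (combV K (suc n) s g t h) v≉0 λ i j → trans (solve 5 (λ v s g t h → v :* (s :* g :+ t :* h) := s :* (v :* g) :+ t :* (v :* h)) refl (v i) s (g j) t (h j))
      (trace-zero-ext {s *ₗ (v ⊗ g) +ᴹ t *ₗ (v ⊗ h)} {0ᴹ} (trace-comb s t (v ⊗ g) (v ⊗ h) (trace-⊗ v g gv≈0) (trace-⊗ v h hv≈0)) trace-0 eq i j))) ,
    (λ x ((c , _ , v≈) , s , t , d , _ , f≈) → c * (d * s) , c * (d * t) , λ (i , j) _ → trans (*-cong (v≈ i) (f≈ j))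
      (solve 7 (λ c d v s g t h → (c :* v) :* (d :* (s :* g :+ t :* h)) := (c :* (d :* s)) :* (v :* g) :+ (c :* (d :* t)) :* (v :* h)) refl c d (v i) s (g j) t (h j))) ,
    λ w w≉0 (s , t , w≈) →
      let f = combV K (suc n) s g t h
          w≈vf : ∀ ij → ij ≢ corner → w ij ≈ (v ⊗ f) ij
          w≈vf (i , j) q = trans (w≈ (i , j) q) (solve 5 (λ v s g t h → s :* (v :* g) :+ t :* (v :* h) := v :* (s :* g :+ t :* h)) refl (v i) s (g j) t (h j))
          x = flag v f v≉0 (λ f≈0 → w≉0 λ (i , j) q → trans (w≈vf (i , j) q) (trans (*-congˡ (f≈0 j)) (zeroʳ _)))
                (trans (⟨⟩-+ˡ (λ i → s * g i) (λ i → t * h i) v) (trans (+-cong (trans (⟨⟩-*ˡ s g v) (*-congˡ gv≈0)) (trans (⟨⟩-*ˡ t h v) (*-congˡ hv≈0)))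
                  (solve 2 (λ s t → s :* :0 :+ t :* :0 := :0) refl s t)))
      in x , (≈⇒∥ (λ _ → refl) , s , t , ≈⇒∥ (λ _ → refl)) , 1# , 1≉0 , λ ij q → trans (w≈vf ij q) (sym (*-identityˡ _))
  onto-lines (flat f a b f≉0 ind fa≈0 fb≈0) = a ⊗ f , b ⊗ f ,
    (λ s t eq → ind s t (⊗-zero f (combV K (suc n) s a t b) f≉0 λ j i → trans (solve 5 (λ f s a t b → f :* (s :* a :+ t :* b) := s :* (a :* f) :+ t :* (b :* f)) refl (f j) s (a i) t (b i))
      (trace-zero-ext {s *ₗ (a ⊗ f) +ᴹ t *ₗ (b ⊗ f)} {0ᴹ} (trace-comb s t (a ⊗ f) (b ⊗ f) (trace-⊗ a f fa≈0) (trace-⊗ b f fb≈0)) trace-0 eq i j))) ,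
    (λ x ((c , _ , f≈) , s , t , d , _ , v≈) → c * (d * s) , c * (d * t) , λ (i , j) _ → trans (*-cong (v≈ i) (f≈ j))
      (solve 7 (λ c d f s a t b → (d :* (s :* a :+ t :* b)) :* (c :* f) := (c :* (d :* s)) :* (a :* f) :+ (c :* (d :* t)) :* (b :* f)) refl c d (f j) s (a i) t (b i))) ,
    λ w w≉0 (s , t , w≈) →
      let v = combV K (suc n) s a t b
          w≈vf : ∀ ij → ij ≢ corner → w ij ≈ (v ⊗ f) ij
          w≈vf (i , j) q = trans (w≈ (i , j) q) (solve 5 (λ f s a t b → s :* (a :* f) :+ t :* (b :* f) := (s :* a :+ t :* b) :* f) refl (f j) s (a i) t (b i))
          x = flag v f (λ v≈0 → w≉0 λ (i , j) q → trans (w≈vf (i , j) q) (trans (*-congʳ (v≈0 i)) (zeroˡ _))) f≉0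
                (trans (⟨⟩-+ʳ f (λ i → s * a i) (λ i → t * b i)) (trans (+-cong (trans (⟨⟩-*ʳ f s a) (*-congˡ fa≈0)) (trans (⟨⟩-*ʳ f t b) (*-congˡ fb≈0)))
                  (solve 2 (λ s t → s :* :0 :+ t :* :0 := :0) refl s t)))
      in x , (≈⇒∥ (λ _ → refl) , s , t , ≈⇒∥ (λ _ → refl)) , 1# , 1≉0 , λ ij q → trans (w≈vf ij q) (sym (*-identityˡ _))

  Terms : Set _
  Terms = List (Carrier × GrPoint K (suc n))

  total : Terms → Carrierᴹ
  total cs = sumListᴹ W (List.map (λ { (s , x) → s *ₗ e x }) cs)

  total-++ : ∀ cs ds → total (cs ++ ds) ≈ᴹ (total cs +ᴹ total ds)
  total-++ []             ds = ≈ᴹ-sym (+ᴹ-identityˡ (total ds))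
  total-++ ((s , x) ∷ cs) ds = ≈ᴹ-trans (+ᴹ-cong {s *ₗ e x} ≈ᴹ-refl (total-++ cs ds)) (≈ᴹ-sym (+ᴹ-assoc (s *ₗ e x) (total cs) (total ds)))

  total-* : ∀ a cs → total (List.map (λ { (s , x) → a * s , x }) cs) ≈ᴹ (a *ₗ total cs)
  total-* a []             = ≈ᴹ-sym (*ₗ-zeroʳ a)
  total-* a ((s , x) ∷ cs) = ≈ᴹ-trans (+ᴹ-cong (*ₗ-assoc a s (e x)) (total-* a cs)) (≈ᴹ-sym (*ₗ-distribˡ a (s *ₗ e x) (total cs)))

  open FunctionSubmodule K isField (Index × Index) (_≢ corner)

  Spanned : Carrierᴹ → Set _
  Spanned w = ∃ λ (cs : Terms) → w ≈ᴹ total cs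

  Spanned-isSubmodule : IsSubmodule Spanned
  Spanned-isSubmodule = record
    { resp   = λ { u≈v (cs , u≈) → cs , ≈ᴹ-trans (≈ᴹ-sym u≈v) u≈ }
    ; zero-∈ = [] , ≈ᴹ-refl
    ; +-∈    = λ { (cs , u≈) (ds , v≈) → cs ++ ds , ≈ᴹ-trans (+ᴹ-cong u≈ v≈) (≈ᴹ-sym (total-++ cs ds)) }
    ; *-∈    = λ { a (cs , u≈) → List.map (λ { (s , x) → a * s , x }) cs , ≈ᴹ-trans (*ₗ-cong refl u≈) (≈ᴹ-sym (total-* a cs)) }
    }

  open IsSubmodule Spanned-isSubmodule

  e-∈ : ∀ x → Spanned (e x)
  e-∈ x = (1# , x) ∷ [] , λ _ _ → sym (trans (+-identityʳ _) (*-identityˡ _))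

  unit-∈ : ∀ i j → Spanned (δ i ⊗ δ j)
  unit-∈ i j with i F.≟ j
  unit-∈ i       j        | no i≢j     = e-∈ (δ-flag i j i≢j)
  -- This matrix lives in the ignored corner, so it is zero in `W`.
  unit-∈ zero    .zero    | yes ≡.refl = resp 0≈ zero-∈
    where
    0≈ : 0ᴹ ≈ᴹ (δ zero ⊗ δ zero)
    0≈ (zero  , zero)  q = ⊥-elim (q ≡.refl)
    0≈ (zero  , suc j) _        = sym (zeroʳ _)
    0≈ (suc i , j)     _        = sym (zeroˡ _)
  unit-∈ (suc i) .(suc i) | yes ≡.refl =
    -- Expanding (δ₀ + δᵢ) ⊗ (δ₀ - δᵢ) and cancelling the two mixed terms leaves δᵢ ⊗ δᵢ - δ₀ ⊗ δ₀,
    -- whose second term is invisible in `W`.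
    resp eq (+-∈ (*-∈ (- 1#) (+-∈ (e-∈ (line-flag 1# zero (suc i) 0≢suc)) (e-∈ (δ-flag zero (suc i) 0≢suc))))
                 (e-∈ (δ-flag (suc i) zero λ ())))
    where
    eq : _ ≈ᴹ (δ (suc i) ⊗ δ (suc i))
    eq (a , b) q = trans
      (solve 4 (λ x y z w → (:- :1) :* ((x :+ :1 :* y) :* (:1 :* z :- w) :+ x :* w) :+ y :* z := y :* w :- x :* z)
        refl (δ zero a) (δ (suc i) a) (δ zero b) (δ (suc i) b))
      (trans (+-congˡ (-‿cong (corner-zero a b q))) (solve 1 (λ x → x :- :0 := x) refl _))
      where
      corner-zero : ∀ a b → (a , b) ≢ corner → δ zero a * δ zero b ≈ 0#
      corner-zero zero    zero    q = ⊥-elim (q ≡.refl)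
      corner-zero zero    (suc b) _        = zeroʳ _
      corner-zero (suc a) b       _        = zeroˡ _

  spanning : ∀ w → Spanned w
  spanning w = resp w≈ (sum-∈ Spanned-isSubmodule size (λ i ab → sum (λ j → w (i , j) * (δ i ⊗ δ j) ab)) λ i →
    sum-∈ Spanned-isSubmodule size (λ j ab → w (i , j) * (δ i ⊗ δ j) ab) λ j → *-∈ (w (i , j)) (unit-∈ i j))
    where
    w≈ : (λ ab → sum (λ i → sum (λ j → w (i , j) * (δ i ⊗ δ j) ab))) ≈ᴹ w
    w≈ (a , b) _ = begin
      sum (λ i → sum (λ j → w (i , j) * (δ i a * δ j b)))
        ≈⟨ sum-cong-≋ {size} (λ i → trans (sum-cong-≋ {size} λ j → solve 3 (λ w x y → w :* (x :* y) := x :* (w :* y)) refl (w (i , j)) (δ i a) (δ j b))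
             (trans (sym (*-distribˡ-sum (δ i a) (λ j → w (i , j) * δ j b))) (trans (*-congˡ (basis-expansion (λ j → w (i , j)) b)) (*-comm _ _)))) ⟩
      sum (λ i → w (i , b) * δ i a)
        ≈⟨ basis-expansion (λ i → w (i , b)) a ⟩
      w (a , b) ∎

  embedding : ProjectiveEmbedding (Gr1n K (suc n)) ring W
  embedding = record
    { isDivisionRing = isField
    ; e              = e
    ; nonzero        = λ x ex≈0 → fun≢0 x (⊗-zero (vec x) (fun x) (vec≢0 x) (trace-zero-ext {e x} {0ᴹ} (trace-e x) trace-0 ex≈0))
    ; well-defined   = λ { x y ((c , c≉0 , v≈) , (d , d≉0 , f≈)) → c * d , *-nonzero c≉0 d≉0 , λ (i , j) _ →
        trans (*-cong (v≈ i) (f≈ j)) (solve 4 (λ c d v f → (c :* v) :* (d :* f) := (c :* d) :* (v :* f)) refl c d (vec x i) (fun x j)) }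
    ; injective      = λ { x y (c , _ , ey≈) →
        let ey≈cex = trace-zero-ext {e y} {c *ₗ e x} (trace-e y) (trace-* c (e x) (trace-e x)) ey≈ in
        ⊗-injective {vec x} {fun x} (vec≢0 y) (fun≢0 y) ey≈cex ,
        ⊗-injective {fun x} {vec x} (fun≢0 y) (vec≢0 y) (λ j i → trans (*-comm _ _) (trans (ey≈cex i j) (*-congˡ (*-comm _ _)))) }
    ; onto-lines     = onto-lines
    ; spanning       = spanning
    }

  unit : Fin (size ^ 2) → Carrierᴹ
  unit l = let (i , j) = entry size l in δ i ⊗ δ j

  entry-injective : ∀ l m → entry size l ≡ entry size m → l ≡ m
  entry-injective l m eq = ≡.trans (≡.sym (position-entry size l)) (≡.trans (≡.cong (λ (i , j) → position size i j) eq) (position-entry size m))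

  unit-entry : ∀ l m → unit l (entry size m) ≈ δ l m
  unit-entry l m with l F.≟ m
  ... | yes ≡.refl = trans (*-cong (δ-diagonal (proj₁ (entry size l))) (δ-diagonal (proj₂ (entry size l)))) (trans (*-identityˡ 1#) (sym (δ-diagonal l)))
  ... | no l≢m with proj₁ (entry size l) F.≟ proj₁ (entry size m) | proj₂ (entry size l) F.≟ proj₂ (entry size m)
  ...   | no i≢ | _     = trans (*-congʳ (δ-off-diagonal i≢)) (trans (zeroˡ _) (sym (δ-off-diagonal l≢m)))
  ...   | yes _ | no j≢ = trans (*-congˡ (δ-off-diagonal j≢)) (trans (zeroʳ _) (sym (δ-off-diagonal l≢m)))
  ...   | yes i≡ | yes j≡ = ⊥-elim (l≢m (entry-injective l m (≡.cong₂ _,_ i≡ j≡)))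

  sumᴹ-at : ∀ m (u : Fin m → Carrierᴹ) ij → sumᴹ W m u ij ≡ sum (λ l → u l ij)
  sumᴹ-at zero    u ij = ≡.refl
  sumᴹ-at (suc m) u ij = ≡.cong (u zero ij +_) (sumᴹ-at m (u ∘ suc) ij)

  -- Position zero is the corner, so the positions `suc l` run over the entries that `W` sees;
  -- evaluation at one of them reads off its coefficient.
  dimension-≥ : DimAtLeast W (size ^ 2 ∸ 1)
  dimension-≥ = (λ l → unit (suc l)) , λ cs eq m → begin
    cs m                                                        ≈⟨ basis-expansion cs m ⟨
    sum (λ l → cs l * δ l m)                                    ≈⟨ sum-cong-≋ {size ^ 2 ∸ 1} (λ l → *-congˡ {cs l} (unit-entry (suc l) (suc m))) ⟨
    sum (λ l → cs l * unit (suc l) (entry size (suc m)))        ≡⟨ sumᴹ-at (size ^ 2 ∸ 1) (λ l → cs l *ₗ unit (suc l)) (entry size (suc m)) ⟨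
    sumᴹ W (size ^ 2 ∸ 1) (λ l → cs l *ₗ unit (suc l)) (entry size (suc m))
      ≈⟨ eq (entry size (suc m)) (λ m≡corner → suc≢zero (≡.trans (≡.sym (position-entry size (suc m))) (≡.cong (λ (i , j) → position size i j) m≡corner))) ⟩
    0#                                                          ∎
    where
    suc≢zero : ∀ {m} {i : Fin m} → Fin.suc i ≢ zero
    suc≢zero ()

theorem1p5 : ∀ {k ℓk} (p : ℕ) → Prime p →
    (K : CommutativeRing k ℓk) → IsAlgebraicClosureOfFp K p →
    (n : ℕ) → 3 ≤ n →
    HasInfiniteGeneratingRank (Gr1n K n)
    ×ω EmbeddingRankBetween (Gr1n K n) (suc n ^ 2 ∸ 1) (suc n ^ 2)
theorem1p5 p pr K closure (suc (suc n)) 3≤n =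
  GeneratingRank.infinite K pr closure (suc n) ,ω record
    { upper = EmbeddingRankUpper.dimension-≤ K pr closure n
    ; lower = record
      { D         = CommutativeRing.ring K
      ; W         = EmbeddingRankLower.W K pr closure (suc n)
      ; embedding = EmbeddingRankLower.embedding K pr closure (suc n)
      ; dimension = EmbeddingRankLower.dimension-≥ K pr closure (suc n)
      }
    }
theorem1p5 p pr K closure (suc zero) (s≤s ())
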